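{- Let $n\geq 10$ be an integer with $n\equiv 1\pmod 3$, let $E=E(W_n)$ be the eccentricity matrix of the wheel graph $W_n$, and let $\mathbf{w}=\frac{1}{6}(7-n,1,\dots,1)'\in\mathbb{R}^n$. Let $\hat{L}$ be the $n\times n$ matrix $$\hat{L}=\frac{n-1}{3}I_n-\frac13\begin{bmatrix}0&\mathbf{e}'\\ \mathbf{e}&\mathbf{0}\end{bmatrix}+\begin{bmatrix}0&\mathbf{0}'\\ \mathbf{0}&P\end{bmatrix},$$ where $P$ is the $(n-1)\times(n-1)$ circulant matrix defined in the context. Then the Moore-Penrose inverse $E^{\dagger}$ of $E$ is $$E^{\dagger}=-\frac12\hat{L}+\frac{6}{n-1}\mathbf{w}\mathbf{w}'.$$
   Context: The prime denotes transpose, $I_n$ is the identity matrix, and $\mathbf{e}$ denotes the all-ones column vector (here in $\mathbb{R}^{n-1}$). In the block matrices the blocks have sizes $1$ and $n-1$. For a vector $\mathbf{c}=(c_1,\dots,c_m)'$, $\operatorname{Circ}(\mathbf{c}')$ is the $m\times m$ circulant matrix with first row $(c_1,\dots,c_m)$ and each subsequent row the cyclic right shift by one of the previous row. Definition of $P$ (for $n\equiv 1\pmod 3$, $n\ge 10$). Let $\mathbf{e_i}$ be the $i$-th standard basis vector of $\mathbb{R}^{n-1}$ and $\mathbf{c_k}=\mathbf{e_{k+1}}+\mathbf{e_{n-k}}\in\mathbb{R}^{n-1}$, for $1\le k\le \frac{n-2}{2}$ if $n$ is even and $1\le k\le\frac{n-3}{2}$ if $n$ is odd. If $n$ is even, $P=\frac{1}{3(n-1)}\operatorname{Circ}(\mathbf{z_1}')$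 with $$\mathbf{z_1}=(2n-n^2)\mathbf{e_1}+\sum_{k=1}^{\frac{n-4}{6}}\left(\frac{3n-18k+8}{2}\mathbf{c_{3k-2}}-\frac{3n-18k+4}{2}\mathbf{c_{3k-1}}+\mathbf{c_{3k}}\right)+\mathbf{c_{\frac n2-1}}.$$ If $n$ is odd, $P=\frac{1}{3(n-1)}\operatorname{Circ}(\mathbf{z_2}')$ with $$\mathbf{z_2}=(2n-n^2)\mathbf{e_1}+\sum_{k=1}^{\frac{n-1}{6}}\left(\frac{3n-18k+8}{2}\mathbf{c_{3k-2}}-\frac{3n-18k+4}{2}\mathbf{c_{3k-1}}\right)+\sum_{k=1}^{\frac{n-7}{6}}\mathbf{c_{3k}}+\mathbf{e_{\frac{n+1}{2}}}.$$ The Moore-Penrose inverse of a real $m\times n$ matrix $A$ is the unique $n\times m$ matrix $X=A^{\dagger}$ with $AXA=A$, $XAX=X$, $(AX)'=AX$, $(XA)'=XA$. For a simple connected graph $G$ with vertices $v_1,\dots,v_n$, let $d(v_i,v_j)$ be the length of a shortest path between $v_i$ and $v_j$, and let $e(v_i)=\max\{d(v_i,v_j):1\le j\le n\}$. The eccentricity matrix $E(G)$ is the $n\times n$ real matrix with $(E(G))_{ij}=d(v_i,v_j)$ if $d(v_i,v_j)=\min\{e(v_i),e(v_j)\}$, and $(E(G))_{ij}=0$ otherwise. The wheel graph $W_n$ is the graph on $n$ vertices consisting of a cycle of length $n-1$ together with one further vertex (the hub) adjacent to every vertex of the cycle. The vertices are labelled so that $v_1$ is the hub and $v_2,\dots,v_n$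 are the cycle vertices in cyclic order. -}

module Defs where

open import Algebra.Bundles using (RawRing)
import Algebra.Definitions.RawMonoid as RawMonoidDefs
open import Data.Bool.Base using (if_then_else_)
open import Data.Empty using (⊥)
open import Data.Fin.Base using (Fin; zero; suc; toℕ; inject₁)
open import Data.Fin.Properties using (any?) renaming (_≟_ to _≟ᶠ_)
open import Data.Integer.Base using (+_)
open import Data.Nat.Base as ℕ using (ℕ; zero; suc; _≤_; _∸_; _⊔_; _⊓_; NonZero; s≤s; s≤s⁻¹)
open import Data.Nat.Divisibility using (_∣?_)
open import Data.Nat.GeneralisedArithmetic using (fold)
open import Data.Nat.Properties using (_≟_; 1+n≢n; ≤-trans; m≤m+n; m*n≢0)
open import Data.Product.Base using (_×_; ∃-syntax; _,_; proj₁)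
open import Data.Rational.Base as ℚ using (ℚ; 0ℚ; 1ℚ; ½)
open import Data.Sum.Base using (_⊎_; inj₁; inj₂; swap)
open import Data.Unit.Base using (⊤; tt)
open import Data.Vec.Functional using (Vector; _∷_; replicate; last; zipWith; transpose)
import Data.Vec.Functional as Vector
open import Function.Base using (_∘_)
open import Level using (0ℓ) renaming (_⊔_ to _⊔ˡ_)
open import Relation.Binary.Core using (Rel)
import Relation.Binary.Definitions as B
open import Relation.Binary.PropositionalEquality.Core using (_≡_; refl; sym; trans; cong)
open import Relation.Nullary.Decidable.Core using (Dec; yes; no; does; _×-dec_; _⊎-dec_)
open import Relation.Nullary.Negation.Core using (¬_)
open import Relation.Unary using (Decidable)

Matrix : ∀ {a} → Set a → ℕ → ℕ → Set a
Matrix A m n = Vector (Vector A n) m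

module MatrixOps {c ℓ} (R : RawRing c ℓ) where
  open RawRing R
  open RawMonoidDefs +-rawMonoid public using (sum)

  infix  4 _≈ᴹ_
  infixl 6 _+ᴹ_ _-ᴹ_
  infixl 7 _*ᴹ_
  infixr 7 _·ᴹ_

  _≈ᴹ_ : ∀ {m n} → Matrix Carrier m n → Matrix Carrier m n → Set ℓ
  A ≈ᴹ B = ∀ i j → A i j ≈ B i j

  _+ᴹ_ : ∀ {m n} → Matrix Carrier m n → Matrix Carrier m n → Matrix Carrier m n
  (A +ᴹ B) i j = A i j + B i j

  _-ᴹ_ : ∀ {m n} → Matrix Carrier m n → Matrix Carrier m n → Matrix Carrier m n
  (A -ᴹ B) i j = A i j + (- B i j)

  _·ᴹ_ : ∀ {m n} → Carrier → Matrix Carrier m n → Matrix Carrier m n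
  (a ·ᴹ A) i j = a * A i j

  _*ᴹ_ : ∀ {l m n} → Matrix Carrier l m → Matrix Carrier m n → Matrix Carrier l n
  (A *ᴹ B) i j = sum (λ k → A i k * B k j)

  record PenroseEquations {m n} (A : Matrix Carrier m n) (X : Matrix Carrier n m) : Set ℓ where
    field
      AXA≈A : A *ᴹ X *ᴹ A ≈ᴹ A
      XAX≈X : X *ᴹ A *ᴹ X ≈ᴹ X
      AX-sym : transpose (A *ᴹ X) ≈ᴹ A *ᴹ X
      XA-sym : transpose (X *ᴹ A) ≈ᴹ X *ᴹ A

  record IsMoorePenroseInverse {m n} (A : Matrix Carrier m n) (X : Matrix Carrier n m)
         : Set (c ⊔ˡ ℓ) where
    field
      penrose : PenroseEquations A X
      unique  : ∀ Y → PenroseEquations A Y → Y ≈ᴹ X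

mapᴹ : ∀ {a b} {A : Set a} {B : Set b} {m n} → (A → B) → Matrix A m n → Matrix B m n
mapᴹ f = Vector.map (Vector.map f)

------------------------------------------------------------------------
-- Connected simple graphs, distance and the eccentricity matrix

Walk : ∀ {n} → Rel (Fin n) 0ℓ → ℕ → Rel (Fin n) 0ℓ
Walk Adj zero    u v = u ≡ v
Walk Adj (suc k) u v = ∃[ w ] (Adj u w × Walk Adj k w v)

walk? : ∀ {n} {Adj : Rel (Fin n) 0ℓ} → B.Decidable Adj →
        ∀ u v k → Dec (Walk Adj k u v)
walk? adj? u v zero    = u ≟ᶠ v
walk? adj? u v (suc k) = any? (λ w → adj? u w ×-dec walk? adj? w v k)

record ConnectedGraph (n : ℕ) : Set₁ where
  field
    Adj       : Rel (Fin n) 0ℓ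
    adj?      : B.Decidable Adj
    symmetric : B.Symmetric Adj
    loopless  : ∀ v → ¬ Adj v v
    connected : ∀ u v → ∃[ k ] Walk Adj k u v

-- The least k ≤ b with P k, provided P b holds.
least : {P : ℕ → Set} → Decidable P → (b : ℕ) → ℕ
least P? zero    = 0
least P? (suc b) = if does (P? 0) then 0 else suc (least (P? ∘ suc) b)

module _ {n : ℕ} (G : ConnectedGraph n) where
  open ConnectedGraph G

  -- A walk of minimal length repeats no vertex, so this is the length of a
  -- shortest path; the walk given by connectedness bounds the search.
  dist : Fin n → Fin n → ℕ
  dist u v = least (walk? adj? u v) (proj₁ (connected u v))

  ecc : Fin n → ℕ
  ecc v = Vector.foldr _⊔_ 0 (dist v)

  eccMatrix : Matrix ℕ n n
  eccMatrix u v = if does (dist u v ≟ ecc u ⊓ ecc v) then dist u v else 0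

------------------------------------------------------------------------
-- The wheel graph with a cycle of length m: vertex zero is the hub, and
-- suc i, for i : Fin m, are the cycle vertices in cyclic order

module _ {m : ℕ} where

  Next : Rel (Fin m) 0ℓ
  Next i j = suc (toℕ i) ≡ toℕ j ⊎ (suc (toℕ i) ≡ m × toℕ j ≡ 0)

  next? : B.Decidable Next
  next? i j = (suc (toℕ i) ≟ toℕ j) ⊎-dec ((suc (toℕ i) ≟ m) ×-dec (toℕ j ≟ 0))

  next-irrefl : 3 ≤ m → ∀ i → ¬ Next i i
  next-irrefl 3≤m       i (inj₁ eq)       = 1+n≢n eq
  next-irrefl (s≤s 2≤m) i (inj₂ (eq , z)) with trans (sym eq) (cong suc z)
  next-irrefl (s≤s ())  i (inj₂ (eq , z)) | refl

  WheelAdj : Rel (Fin (suc m)) 0ℓ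
  WheelAdj zero    zero    = ⊥
  WheelAdj zero    (suc j) = ⊤
  WheelAdj (suc i) zero    = ⊤
  WheelAdj (suc i) (suc j) = Next i j ⊎ Next j i

  wheelAdj? : B.Decidable WheelAdj
  wheelAdj? zero    zero    = no λ ()
  wheelAdj? zero    (suc j) = yes tt
  wheelAdj? (suc i) zero    = yes tt
  wheelAdj? (suc i) (suc j) = next? i j ⊎-dec next? j i

  wheelAdj-sym : B.Symmetric WheelAdj
  wheelAdj-sym {zero}  {suc j} _ = tt
  wheelAdj-sym {suc i} {zero}  _ = tt
  wheelAdj-sym {suc i} {suc j} a = swap a

  wheelAdj-irrefl : 3 ≤ m → ∀ v → ¬ WheelAdj v v
  wheelAdj-irrefl 3≤m zero    ()
  wheelAdj-irrefl 3≤m (suc i) (inj₁ a) = next-irrefl 3≤m i a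
  wheelAdj-irrefl 3≤m (suc i) (inj₂ a) = next-irrefl 3≤m i a

  wheel-connected : ∀ u v → ∃[ k ] Walk WheelAdj k u v
  wheel-connected zero    zero    = 0 , refl
  wheel-connected zero    (suc j) = 1 , suc j , tt , refl
  wheel-connected (suc i) zero    = 1 , zero , tt , refl
  wheel-connected (suc i) (suc j) = 2 , zero , tt , suc j , tt , refl

wheel : (m : ℕ) → 3 ≤ m → ConnectedGraph (suc m)
wheel m 3≤m = record
  { Adj       = WheelAdj {m}
  ; adj?      = wheelAdj?
  ; symmetric = wheelAdj-sym
  ; loopless  = wheelAdj-irrefl 3≤m
  ; connected = wheel-connected
  }

10≤1+m⇒3≤m : ∀ {m} → 10 ≤ suc m → 3 ≤ m
10≤1+m⇒3≤m 10≤n = ≤-trans (m≤m+n 3 6) (s≤s⁻¹ 10≤n)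

------------------------------------------------------------------------
-- The matrices E, P and L̂ and the vector w, over ℚ

open MatrixOps ℚ.+-*-rawRing using (sum)
open MatrixOps ℚ.+-*-rawRing public using (_·ᴹ_; _+ᴹ_; _-ᴹ_)

infix 9 ↑_

↑_ : ℕ → ℚ
↑ k = + k ℚ./ 1

shiftʳ : ∀ {a} {A : Set a} {m} → Vector A m → Vector A m
shiftʳ {m = suc m} v = last v ∷ (v ∘ inject₁)

Circ : ∀ {a} {A : Set a} {m} → Vector A m → Matrix A m m
Circ c i = fold c shiftʳ (toℕ i)

identity : ∀ {n} → Matrix ℚ n n
identity i j = if does (i ≟ᶠ j) then 1ℚ else 0ℚ

block : ∀ {m} → ℚ → Vector ℚ m → Vector ℚ m → Matrix ℚ m m → Matrix ℚ (suc m) (suc m)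
block a row col D = (a ∷ row) ∷ zipWith _∷_ col D

outer : ∀ {n} → Vector ℚ n → Vector ℚ n → Matrix ℚ n n
outer u v i j = u i ℚ.* v j

-- ∑[ K ] f = f 1 + … + f K
∑[_]_ : ℕ → (ℕ → ℚ) → ℚ
∑[ K ] f = sum {K} (λ i → f (suc (toℕ i)))

infix 5 ∑[_]_

-- Throughout, n = m + 1; vectors have length n - 1 = m, and the indices of
-- e and c are 1-based.
module _ (m : ℕ) where
  private
    n : ℕ
    n = suc m

  E : 10 ≤ n → Matrix ℚ n n
  E n≥10 = mapᴹ ↑_ (eccMatrix (wheel m (10≤1+m⇒3≤m n≥10)))

  e : ℕ → Vector ℚ m
  e i j = if does (suc (toℕ j) ≟ i) then 1ℚ else 0ℚ

  c : ℕ → Vector ℚ m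
  c k j = e (k ℕ.+ 1) j ℚ.+ e (n ∸ k) j

  α β : ℕ → ℚ
  α k = (↑ 3 ℚ.* ↑ n ℚ.- ↑ 18 ℚ.* ↑ k ℚ.+ ↑ 8) ℚ.* ½
  β k = (↑ 3 ℚ.* ↑ n ℚ.- ↑ 18 ℚ.* ↑ k ℚ.+ ↑ 4) ℚ.* ½

  -- All truncated subtractions and floor divisions below are exact: z₁ is
  -- used only for n ≡ 4 (mod 6), and z₂ only for n ≡ 1 (mod 6), with n ≥ 10.
  z₁ z₂ : Vector ℚ m
  z₁ j = (↑ 2 ℚ.* ↑ n ℚ.- ↑ n ℚ.* ↑ n) ℚ.* e 1 j
         ℚ.+ (∑[ (n ∸ 4) ℕ./ 6 ] λ k →
                α k ℚ.* c (3 ℕ.* k ∸ 2) j ℚ.- β k ℚ.* c (3 ℕ.* k ∸ 1) j ℚ.+ c (3 ℕ.* k) j)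
         ℚ.+ c (n ℕ./ 2 ∸ 1) j
  z₂ j = (↑ 2 ℚ.* ↑ n ℚ.- ↑ n ℚ.* ↑ n) ℚ.* e 1 j
         ℚ.+ (∑[ (n ∸ 1) ℕ./ 6 ] λ k →
                α k ℚ.* c (3 ℕ.* k ∸ 2) j ℚ.- β k ℚ.* c (3 ℕ.* k ∸ 1) j)
         ℚ.+ (∑[ (n ∸ 7) ℕ./ 6 ] λ k → c (3 ℕ.* k) j)
         ℚ.+ e ((n ℕ.+ 1) ℕ./ 2) j

  w : Vector ℚ n
  w = Vector.map ((+ 1 ℚ./ 6) ℚ.*_) ((↑ 7 ℚ.- ↑ n) ∷ replicate m 1ℚ)

  module _ .{{_ : NonZero m}} where

    P : Matrix ℚ m m
    P = ((+ 1 ℚ./ (3 ℕ.* m)) {{m*n≢0 3 m}}) ·ᴹ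
        (if does (2 ∣? n) then Circ z₁ else Circ z₂)

    L̂ : Matrix ℚ n n
    L̂ = (+ m ℚ./ 3) ·ᴹ identity
        -ᴹ (+ 1 ℚ./ 3) ·ᴹ block 0ℚ (replicate m 1ℚ) (replicate m 1ℚ) (λ _ _ → 0ℚ)
        +ᴹ block 0ℚ (replicate m 0ℚ) (replicate m 0ℚ) P

{-# OPTIONS --safe #-}
module Submission where

-- Let N = I + S + S⁻¹ on functions on the cycle ℤ/m, S being the rotation.  Then
-- E = [0, e′; e, 2J - 2N] and the claimed inverse is X = [a, ρe′; ρe, Y], where
-- ρ = 1/m, a = ρ(6 - 2m) and Y is circulant.  The kernel of N consists of the
-- 3-periodic functions with sum zero; T, with entries 3ρ where i ≡ j (mod 3) and 0
-- elsewhere, is the projection onto all 3-periodic functions.  The closed form of P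
-- amounts to: the first row of Y is y(3q) = 0, y(3q+1) = h q, y(3q+2) = - h q with
-- h q = (2q + 1 - m/3)·3ρ/4, whence NY = ½(T - I).  So EX = XE = [1, 0; 0, I - T + ρJ],
-- which is symmetric and fixes E.  It fixes X as soon as TY = 0, and this follows from
-- Y = NZ for an explicit circulant Z, because NT = 3ρJ and the columns of Z sum to zero.

open import Defs
open import Algebra.Bundles using (CommutativeRing; RawRing)
open import Algebra.Morphism.Structures using (module RingMorphisms)
import Algebra.Properties.Semiring.Sum as SemiringSum
open import Data.Bool.Base using (true; false; if_then_else_)
open import Data.Fin.Base using (Fin; zero; suc; toℕ; fromℕ; inject₁; fromℕ<)
open import Data.Fin.Induction using (<-weakInduction)
open import Data.Fin.Patterns using (0F; 1F; 2F)
open import Data.Fin.Permutation using (Permutation; permutation)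
open import Data.Fin.Properties
  using (toℕ-injective; toℕ<n; toℕ-fromℕ; toℕ-inject₁; toℕ-fromℕ<) renaming (_≟_ to _≟ᶠ_)
open import Data.Fin.Relation.Unary.Top using (view; ‵fromℕ; ‵inject₁; view-fromℕ; view-inject₁)
open import Data.Integer.Base as ℤ using (+_)
import Data.Integer.Properties as ℤ
open import Data.Nat.Base as ℕ using (ℕ; zero; suc; _≤_; _<_; s≤s; z≤n; _∸_; _⊔_; _⊓_; _%_; NonZero)
open import Data.Nat.Divisibility using (_∣_; _∣?_; divides; ∣m+n∣m⇒∣n; >⇒∤)
open import Data.Nat.DivMod using (m*n/n≡m; m≡m%n+[m/n]*n)
open import Data.Nat.GeneralisedArithmetic using (fold)
import Data.Nat.Properties as ℕ
open import Data.Product.Base using (_×_; ∃-syntax; _,_; proj₁; proj₂)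
open import Data.Rational.Base as ℚ using (ℚ; 0ℚ; 1ℚ; ½; toℚᵘ)
open import Data.Sum.Base using (_⊎_; inj₁; inj₂; [_,_])
open import Data.Vec.Functional as Vector using (Vector; replicate; transpose)
open import Function.Base using (_∘_)
import Relation.Binary.Reasoning.Setoid as SetoidReasoning
open import Relation.Nullary.Decidable using (Dec; yes; no; does; dec-true; dec-false)
open import Relation.Nullary.Negation.Core using (contradiction; ¬_)
open import Relation.Unary using (Decidable)

-- Penrose equations over a commutative ring

-- The kernel of `N` shapes the construction: `NY = ½(T - I)` determines the columns of `Y` only up
-- to 3-periodic vectors with sum zero, and a Moore-Penrose inverse has to be the solution
-- orthogonal to them. Exhibiting `Y` in the image of the self-adjoint `N` settles this without
-- spectral theory. The closed form of `h` is forced. Three consecutive values of the row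
-- `0, h q, - h q, 0, ...` add up to zero except around multiples of 3, where they show the
-- increment of `h`; this has to be half of `3ρ`, which gives the slope `3ρ/2`. Symmetry of `Y`
-- makes `h` change sign when its range is reversed, which fixes the constant term. The row of `Z`
-- is built from partial sums of `h`. The two definitions of `P` describe one and the same row as a
-- function of the distance from position 0 on the cycle; the parities of `n` differ only in how the
-- half cycle ends.

module _ {c ℓ} (R : CommutativeRing c ℓ) where
  open CommutativeRing R
  open MatrixOps rawRing using (_*ᴹ_; _≈ᴹ_; PenroseEquations)
  open SemiringSum semiring using (sum; sum-cong-≋; ∑-comm; *-distribˡ-sum; *-distribʳ-sum)
  open SetoidReasoning setoid

  private variable k l m n : ℕ

  *ᴹ-cong : {A A′ : Matrix Carrier l m} {B B′ : Matrix Carrier m n} →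
            A ≈ᴹ A′ → B ≈ᴹ B′ → A *ᴹ B ≈ᴹ A′ *ᴹ B′
  *ᴹ-cong A≈A′ B≈B′ i j = sum-cong-≋ λ k → *-cong (A≈A′ i k) (B≈B′ k j)

  *ᴹ-assoc : (A : Matrix Carrier k l) (B : Matrix Carrier l m) (C : Matrix Carrier m n) →
             (A *ᴹ B) *ᴹ C ≈ᴹ A *ᴹ (B *ᴹ C)
  *ᴹ-assoc A B C i j = begin
    sum (λ y → sum (λ x → A i x * B x y) * C y j)
      ≈⟨ sum-cong-≋ (λ y → *-distribʳ-sum (C y j) (λ x → A i x * B x y)) ⟩
    sum (λ y → sum (λ x → A i x * B x y * C y j))
      ≈⟨ ∑-comm (λ y x → A i x * B x y * C y j) ⟩
    sum (λ x → sum (λ y → A i x * B x y * C y j))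
      ≈⟨ sum-cong-≋ (λ x → sum-cong-≋ (λ y → *-assoc (A i x) (B x y) (C y j))) ⟩
    sum (λ x → sum (λ y → A i x * (B x y * C y j)))
      ≈⟨ sum-cong-≋ (λ x → *-distribˡ-sum (A i x) (λ y → B x y * C y j)) ⟨
    sum (λ x → A i x * sum (λ y → B x y * C y j)) ∎

  -- Transposition reverses a product; with symmetric factors this just exchanges them.
  symmetric-*ᴹ : {P Q : Matrix Carrier n n} →
    (∀ i j → P j i ≈ P i j) → (∀ i j → Q j i ≈ Q i j) → ∀ i j → (P *ᴹ Q) j i ≈ (Q *ᴹ P) i j
  symmetric-*ᴹ P-sym Q-sym i j = sum-cong-≋ λ k →
    trans (*-comm _ _) (*-cong (Q-sym i k) (P-sym k j))

  -- `AX` and `AY` are symmetric and absorb each other: `AY = (AX)(AY)` and `(AY)(AX) = AX`.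
  -- Transposing the first product gives the second, so `AY = AX`, and likewise `YA = XA`. Then
  -- `Y = YAY = XAY = XAX = X`.
  penrose-unique : (A : Matrix Carrier m n) (X Y : Matrix Carrier n m) →
                   PenroseEquations A X → PenroseEquations A Y → Y ≈ᴹ X
  penrose-unique A X Y pX pY i j = begin
    Y i j                   ≈⟨ pY.XAX≈X i j ⟨
    (Y *ᴹ A *ᴹ Y) i j       ≈⟨ *ᴹ-cong {B = Y} YA≈XA (λ _ _ → refl) i j ⟩
    (X *ᴹ A *ᴹ Y) i j       ≈⟨ *ᴹ-assoc X A Y i j ⟩
    (X *ᴹ (A *ᴹ Y)) i j     ≈⟨ *ᴹ-cong {A = X} (λ _ _ → refl) AY≈AX i j ⟩
    (X *ᴹ (A *ᴹ X)) i j     ≈⟨ *ᴹ-assoc X A X i j ⟨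
    (X *ᴹ A *ᴹ X) i j       ≈⟨ pX.XAX≈X i j ⟩
    X i j                   ∎
    where
    module pX = PenroseEquations pX
    module pY = PenroseEquations pY

    AY≈AX : A *ᴹ Y ≈ᴹ A *ᴹ X
    AY≈AX i j = begin
      (A *ᴹ Y) i j                    ≈⟨ pY.AX-sym i j ⟨
      (A *ᴹ Y) j i                    ≈⟨ *ᴹ-cong {B = Y} pX.AXA≈A (λ _ _ → refl) j i ⟨
      (A *ᴹ X *ᴹ A *ᴹ Y) j i          ≈⟨ *ᴹ-assoc (A *ᴹ X) A Y j i ⟩
      ((A *ᴹ X) *ᴹ (A *ᴹ Y)) j i      ≈⟨ symmetric-*ᴹ {P = A *ᴹ X} {A *ᴹ Y} pX.AX-sym pY.AX-sym i j ⟩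
      ((A *ᴹ Y) *ᴹ (A *ᴹ X)) i j      ≈⟨ *ᴹ-assoc (A *ᴹ Y) A X i j ⟨
      (A *ᴹ Y *ᴹ A *ᴹ X) i j          ≈⟨ *ᴹ-cong {B = X} pY.AXA≈A (λ _ _ → refl) i j ⟩
      (A *ᴹ X) i j                    ∎

    YA≈XA : Y *ᴹ A ≈ᴹ X *ᴹ A
    YA≈XA i j = begin
      (Y *ᴹ A) i j                    ≈⟨ pY.XA-sym i j ⟨
      (Y *ᴹ A) j i                    ≈⟨ *ᴹ-cong {A = Y} (λ _ _ → refl) pX.AXA≈A j i ⟨
      (Y *ᴹ (A *ᴹ X *ᴹ A)) j i        ≈⟨ *ᴹ-cong {A = Y} (λ _ _ → refl) (*ᴹ-assoc A X A) j i ⟩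
      (Y *ᴹ (A *ᴹ (X *ᴹ A))) j i      ≈⟨ *ᴹ-assoc Y A (X *ᴹ A) j i ⟨
      ((Y *ᴹ A) *ᴹ (X *ᴹ A)) j i      ≈⟨ symmetric-*ᴹ {P = Y *ᴹ A} {X *ᴹ A} pY.XA-sym pX.XA-sym i j ⟩
      ((X *ᴹ A) *ᴹ (Y *ᴹ A)) i j      ≈⟨ *ᴹ-assoc X A (Y *ᴹ A) i j ⟩
      (X *ᴹ (A *ᴹ (Y *ᴹ A))) i j      ≈⟨ *ᴹ-cong {A = X} (λ _ _ → refl) (*ᴹ-assoc A Y A) i j ⟨
      (X *ᴹ (A *ᴹ Y *ᴹ A)) i j        ≈⟨ *ᴹ-cong {A = X} (λ _ _ → refl) pY.AXA≈A i j ⟩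
      (X *ᴹ A) i j                    ∎

  -- Matrices are functions compared entry by entry, so closed forms are substituted through this
  -- lemma rather than by rewriting.
  penrose-cong : {A A′ : Matrix Carrier m n} {X X′ : Matrix Carrier n m} →
                 A ≈ᴹ A′ → X ≈ᴹ X′ → PenroseEquations A′ X′ → PenroseEquations A X
  penrose-cong {A = A} {A′} {X} {X′} A≈A′ X≈X′ pen = record
    { AXA≈A  = λ i j → trans (*ᴹ-cong AX≈ A≈A′ i j) (trans (pen.AXA≈A i j) (sym (A≈A′ i j)))
    ; XAX≈X  = λ i j → trans (*ᴹ-cong XA≈ X≈X′ i j) (trans (pen.XAX≈X i j) (sym (X≈X′ i j)))
    ; AX-sym = λ i j → trans (AX≈ j i) (trans (pen.AX-sym i j) (sym (AX≈ i j)))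
    ; XA-sym = λ i j → trans (XA≈ j i) (trans (pen.XA-sym i j) (sym (XA≈ i j)))
    }
    where
    module pen = PenroseEquations pen

    AX≈ : A *ᴹ X ≈ᴹ A′ *ᴹ X′
    AX≈ = *ᴹ-cong A≈A′ X≈X′

    XA≈ : X *ᴹ A ≈ᴹ X′ *ᴹ A′
    XA≈ = *ᴹ-cong X≈X′ A≈A′

  module _ {c′ ℓ′} (S : RawRing c′ ℓ′) (ι : RawRing.Carrier S → Carrier)
           (ι-homo : RingMorphisms.IsRingHomomorphism S rawRing ι) where
    private
      module S = RawRing S
      module Sᴹ = MatrixOps S
    open RingMorphisms.IsRingHomomorphism ι-homo

    sum-homo : (f : Vector S.Carrier n) → ι (Sᴹ.sum f) ≈ sum (ι ∘ f)
    sum-homo {zero}  f = 0#-homo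
    sum-homo {suc n} f = trans (+-homo _ _) (+-congˡ (sum-homo (f ∘ suc)))

    *ᴹ-homo : (A : Matrix S.Carrier l m) (B : Matrix S.Carrier m n) →
              mapᴹ ι A *ᴹ mapᴹ ι B ≈ᴹ mapᴹ ι (A Sᴹ.*ᴹ B)
    *ᴹ-homo A B i j = begin
      sum (λ k → ι (A i k) * ι (B k j))       ≈⟨ sum-cong-≋ (λ k → *-homo (A i k) (B k j)) ⟨
      sum (λ k → ι (A i k S.* B k j))         ≈⟨ sum-homo (λ k → A i k S.* B k j) ⟨
      ι (Sᴹ.sum (λ k → A i k S.* B k j))      ∎

    *ᴹ³-homo : (A : Matrix S.Carrier k l) (B : Matrix S.Carrier l m) (C : Matrix S.Carrier m n) →
               mapᴹ ι A *ᴹ mapᴹ ι B *ᴹ mapᴹ ι C ≈ᴹ mapᴹ ι (A Sᴹ.*ᴹ B Sᴹ.*ᴹ C)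
    *ᴹ³-homo A B C i j = trans (*ᴹ-cong {B = mapᴹ ι C} (*ᴹ-homo A B) (λ _ _ → refl) i j)
                               (*ᴹ-homo (A Sᴹ.*ᴹ B) C i j)

    penrose-homo : {A : Matrix S.Carrier m n} {X : Matrix S.Carrier n m} →
                   Sᴹ.PenroseEquations A X → PenroseEquations (mapᴹ ι A) (mapᴹ ι X)
    penrose-homo {A = A} {X} pen = record
      { AXA≈A  = λ i j → trans (*ᴹ³-homo A X A i j) (⟦⟧-cong (pen.AXA≈A i j))
      ; XAX≈X  = λ i j → trans (*ᴹ³-homo X A X i j) (⟦⟧-cong (pen.XAX≈X i j))
      ; AX-sym = λ i j → trans (*ᴹ-homo A X j i) (trans (⟦⟧-cong (pen.AX-sym i j)) (sym (*ᴹ-homo A X i j)))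
      ; XA-sym = λ i j → trans (*ᴹ-homo X A j i) (trans (⟦⟧-cong (pen.XA-sym i j)) (sym (*ᴹ-homo X A i j)))
      }
      where module pen = Sᴹ.PenroseEquations pen

open import Data.Rational.Base using (_+_; _*_; -_; _-_)
open import Data.Rational.Properties as ℚ
  using (*-comm; *-identityˡ; *-identityʳ; *-zeroˡ; *-zeroʳ; +-assoc; +-identityˡ; +-identityʳ;
      +-*-commutativeRing;
         /-cong; toℚᵘ-fromℚᵘ; toℚᵘ-homo-*; toℚᵘ-homo-+; toℚᵘ-injective)
open import Data.Rational.Solver using (module +-*-Solver)
open import Data.Rational.Unnormalised.Base as ℚᵘ using (mkℚᵘ; *≡*)
import Data.Rational.Unnormalised.Properties as ℚᵘ
open import Relation.Binary.PropositionalEquality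
  using (_≡_; _≢_; refl; sym; trans; cong; cong₂; subst; module ≡-Reasoning)
open +-*-Solver using (solve; _:=_; _:+_; _:*_; _:-_; :-_; con)
open SemiringSum (CommutativeRing.semiring +-*-commutativeRing)
  using (sum; sum-cong-≗; ∑-distrib-+; sum-permute; *-distribˡ-sum; *-distribʳ-sum)
open MatrixOps ℚ.+-*-rawRing using (_*ᴹ_; _≈ᴹ_; PenroseEquations)

-- Rotations and circulant matrices

private variable p : ℕ

prev next : Fin (suc p) → Fin (suc p)
prev zero    = fromℕ _
prev (suc i) = inject₁ i
next i with view i
... | ‵fromℕ     = zero
... | ‵inject₁ j = suc j

next-fromℕ : ∀ p → next (fromℕ p) ≡ zero
next-fromℕ p rewrite view-fromℕ p = refl

next-inject₁ : (i : Fin p) → next (inject₁ i) ≡ suc i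
next-inject₁ i rewrite view-inject₁ i = refl

next-prev : (i : Fin (suc p)) → next (prev i) ≡ i
next-prev zero    = next-fromℕ _
next-prev (suc i) = next-inject₁ i

prev-next : (i : Fin (suc p)) → prev (next i) ≡ i
prev-next i with view i
... | ‵fromℕ     = refl
... | ‵inject₁ j = refl

next-induction : ∀ {a} (Q : Fin (suc p) → Set a) → Q zero → (∀ i → Q i → Q (next i)) → ∀ i → Q i
next-induction Q base step =
  <-weakInduction Q base (λ i Qi → subst Q (next-inject₁ i) (step (inject₁ i) Qi))

-- Invariance under rotating both indices together stands in for dependence on `j - i` modulo the
-- size; it avoids modular subtraction and passes directly to entrywise combinations.
Circulant : ∀ {a} {A : Set a} → Matrix A (suc p) (suc p) → Set a
Circulant A = ∀ i j → A (next i) (next j) ≡ A i j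

module _ {a} {A : Set a} where

  circulant-nextˡ : {M : Matrix A (suc p) (suc p)} → Circulant M → ∀ i j → M (next i) j ≡ M i (prev j)
  circulant-nextˡ {M = M} circ i j =
    trans (cong (M (next i)) (sym (next-prev j))) (circ i (prev j))

  circulant-prevˡ : {M : Matrix A (suc p) (suc p)} → Circulant M → ∀ i j → M (prev i) j ≡ M i (next j)
  circulant-prevˡ {M = M} circ i j =
    trans (sym (circ (prev i) j)) (cong (λ k → M k (next j)) (next-prev i))

  -- Reduces identities between circulants to their first rows. The induction carries all columns at
  -- once, because each row reads the one before it at `prev j`.
  circulant-ext : {M N : Matrix A (suc p) (suc p)} → Circulant M → Circulant N →
                  (∀ j → M zero j ≡ N zero j) → ∀ i j → M i j ≡ N i j
  circulant-ext {M = M} {N} circM circN row₀ = next-induction _ row₀ λ i rowᵢ j → begin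
    M (next i) j ≡⟨ circulant-nextˡ circM i j ⟩
    M i (prev j) ≡⟨ rowᵢ (prev j) ⟩
    N i (prev j) ≡⟨ circulant-nextˡ circN i j ⟨
    N (next i) j ∎
    where open ≡-Reasoning

  -- Entry `j` of row `k` of `Circ c` is `c` at `j - k` modulo the size. This lemma and the next
  -- treat the entries on or above the diagonal and those below it, where the index wraps; additive
  -- equations replace the subtraction.
  fold-shift-above : (c : Vector A (suc p)) → ∀ k i j → toℕ i ℕ.+ k ≡ toℕ j →
                     fold c shiftʳ k j ≡ c i
  fold-shift-above c zero    i j       eq =
    cong c (sym (toℕ-injective (trans (sym (ℕ.+-identityʳ _)) eq)))
  fold-shift-above c (suc k) i zero    eq with () ← trans (sym (ℕ.+-suc (toℕ i) k)) eq
  fold-shift-above c (suc k) i (suc j) eq = fold-shift-above c k i (inject₁ j)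
    (trans (ℕ.suc-injective (trans (sym (ℕ.+-suc (toℕ i) k)) eq)) (sym (toℕ-inject₁ j)))

  fold-shift-below : (c : Vector A (suc p)) → ∀ k i j → toℕ i ℕ.+ k ≡ toℕ j ℕ.+ suc p →
                     fold c shiftʳ k j ≡ c i
  fold-shift-below {p} c zero i j eq = contradiction (toℕ<n i) (ℕ.≤⇒≯ (begin
    suc p             ≤⟨ ℕ.m≤n+m (suc p) (toℕ j) ⟩
    toℕ j ℕ.+ suc p   ≡⟨ eq ⟨
    toℕ i ℕ.+ 0       ≡⟨ ℕ.+-identityʳ _ ⟩
    toℕ i             ∎))
    where open ℕ.≤-Reasoning
  -- Column zero receives the last entry of the previous row: the wrap happens here, and the
  -- remaining index lies on or above the diagonal.
  fold-shift-below {p} c (suc k) i zero eq = fold-shift-above c k i (fromℕ p)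
    (trans (ℕ.suc-injective (trans (sym (ℕ.+-suc (toℕ i) k)) eq)) (sym (toℕ-fromℕ p)))
  fold-shift-below {p} c (suc k) i (suc j) eq = fold-shift-below c k i (inject₁ j)
    (trans (ℕ.suc-injective (trans (sym (ℕ.+-suc (toℕ i) k)) eq))
           (cong (ℕ._+ suc p) (sym (toℕ-inject₁ j))))

  shiftʳ-next : (v : Vector A (suc p)) → ∀ j → shiftʳ v (next j) ≡ v j
  shiftʳ-next v j with view j
  ... | ‵fromℕ     = refl
  ... | ‵inject₁ _ = refl

  -- Each row but the first is by definition the shift of its predecessor. Closing up from the last
  -- row to row zero is not a shift, and is checked on explicit entries.
  Circ-circulant : (c : Vector A (suc p)) → Circulant (Circ c)
  Circ-circulant {p} c i j with view i
  ... | ‵inject₁ i′ = trans (shiftʳ-next (fold c shiftʳ (toℕ i′)) j)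
                            (cong (λ k → fold c shiftʳ k j) (sym (toℕ-inject₁ i′)))
  ... | ‵fromℕ with view j
  ...   | ‵fromℕ      = sym (fold-shift-above c (toℕ (fromℕ p)) zero (fromℕ p) refl)
  ...   | ‵inject₁ j′ = sym (fold-shift-below c (toℕ (fromℕ p)) (suc j′) (inject₁ j′)
            (trans (cong₂ (λ x y → suc (x ℕ.+ y)) (sym (toℕ-inject₁ j′)) (toℕ-fromℕ p)) (sym (ℕ.+-suc _ p))))

identity-≡ : ∀ {n} {i j : Fin n} → i ≡ j → identity i j ≡ 1ℚ
identity-≡ {i = i} {j} eq rewrite dec-true (i ≟ᶠ j) eq = refl

identity-≢ : ∀ {n} {i j : Fin n} → i ≢ j → identity i j ≡ 0ℚ
identity-≢ {i = i} {j} neq rewrite dec-false (i ≟ᶠ j) neq = refl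

identity-cong-⇔ : ∀ {m n} {i j : Fin m} {k l : Fin n} → (i ≡ j → k ≡ l) → (k ≡ l → i ≡ j) →
                  identity i j ≡ identity k l
identity-cong-⇔ {i = i} {j} to from with i ≟ᶠ j
... | yes eq  = sym (identity-≡ (to eq))
... | no  neq = sym (identity-≢ (neq ∘ from))

identity-sym : ∀ {n} (i j : Fin n) → identity i j ≡ identity j i
identity-sym i j = identity-cong-⇔ {i = i} {j} {j} {i} sym sym

next-injective : {i j : Fin (suc p)} → next i ≡ next j → i ≡ j
next-injective {i = i} {j} eq = trans (sym (prev-next i)) (trans (cong prev eq) (prev-next j))

identity-circulant : Circulant {p} identity
identity-circulant i j = identity-cong-⇔ {i = next i} {next j} {i} {j} next-injective (cong next)

-- Rational arithmetic and finite sums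

-- The quotient in ℚ is normalised by a gcd that does not reduce on variables, so arithmetic with
-- quotients is checked on unnormalised representatives.
toℚᵘ-/ : ∀ a k .{{_ : NonZero k}} → toℚᵘ (a ℚ./ k) ℚᵘ.≃ (a ℚᵘ./ k)
toℚᵘ-/ a (suc k) = toℚᵘ-fromℚᵘ (mkℚᵘ a k)

module ≃-Reasoning = ℚᵘ.≃-Reasoning

↑-+ : ∀ a b → ↑ (a ℕ.+ b) ≡ ↑ a + ↑ b
↑-+ a b = toℚᵘ-injective (begin
  toℚᵘ (↑ (a ℕ.+ b))                ≈⟨ toℚᵘ-/ (+ (a ℕ.+ b)) 1 ⟩
  mkℚᵘ (+ (a ℕ.+ b)) 0              ≈⟨ *≡*
      (cong (ℤ._* + 1) (sym (cong₂ ℤ._+_ (ℤ.*-identityʳ (+ a)) (ℤ.*-identityʳ (+ b))))) ⟩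
  mkℚᵘ (+ a) 0 ℚᵘ.+ mkℚᵘ (+ b) 0    ≈⟨ ℚᵘ.+-cong (toℚᵘ-/ (+ a) 1) (toℚᵘ-/ (+ b) 1) ⟨
  toℚᵘ (↑ a) ℚᵘ.+ toℚᵘ (↑ b)        ≈⟨ toℚᵘ-homo-+ (↑ a) (↑ b) ⟨
  toℚᵘ (↑ a + ↑ b)                  ∎)
  where open ≃-Reasoning

/-* : ∀ a b k l .{{_ : NonZero k}} .{{_ : NonZero l}} →
      ((a ℤ.* b) ℚ./ (k ℕ.* l)) {{ℕ.m*n≢0 k l}} ≡ (a ℚ./ k) * (b ℚ./ l)
/-* a b k@(suc _) l@(suc _) = toℚᵘ-injective (begin
  toℚᵘ ((a ℤ.* b) ℚ./ (k ℕ.* l))            ≈⟨ toℚᵘ-/ (a ℤ.* b) (k ℕ.* l) ⟩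
  (a ℚᵘ./ k) ℚᵘ.* (b ℚᵘ./ l)                ≈⟨ ℚᵘ.*-cong (toℚᵘ-/ a k) (toℚᵘ-/ b l) ⟨
  toℚᵘ (a ℚ./ k) ℚᵘ.* toℚᵘ (b ℚ./ l)        ≈⟨ toℚᵘ-homo-* (a ℚ./ k) (b ℚ./ l) ⟨
  toℚᵘ ((a ℚ./ k) * (b ℚ./ l))              ∎)
  where open ≃-Reasoning

↑-* : ∀ a b → ↑ (a ℕ.* b) ≡ ↑ a * ↑ b
↑-* a b = trans (cong (ℚ._/ 1) (ℤ.pos-* a b)) (/-* (+ a) (+ b) 1 1)

/-as-* : ∀ a k .{{_ : NonZero k}} → + a ℚ./ k ≡ ↑ a * (+ 1 ℚ./ k)
/-as-* a k@(suc _) = trans (/-cong (sym (ℤ.*-identityʳ (+ a))) (sym (ℕ.*-identityˡ k)))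
                           (/-* (+ a) (+ 1) 1 k)

↑-inverse : ∀ k .{{_ : NonZero k}} → ↑ k * (+ 1 ℚ./ k) ≡ 1ℚ
↑-inverse k@(suc k-1) = trans (sym (/-as-* k k)) (toℚᵘ-injective (begin
  toℚᵘ (+ k ℚ./ k)   ≈⟨ toℚᵘ-/ (+ k) k ⟩
  mkℚᵘ (+ k) k-1     ≈⟨ *≡* (trans (ℤ.*-identityʳ (+ k)) (sym (ℤ.*-identityˡ (+ k)))) ⟩
  toℚᵘ 1ℚ            ∎))
  where open ≃-Reasoning

sum-replicate-↑ : ∀ n x → sum {n} (λ _ → x) ≡ ↑ n * x
sum-replicate-↑ zero    x = sym (*-zeroˡ x)
sum-replicate-↑ (suc n) x = begin
  x + sum {n} (λ _ → x) ≡⟨ cong (x ℚ.+_) (sum-replicate-↑ n x) ⟩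
  x + ↑ n * x           ≡⟨ solve 2 (λ x n → x :+ n :* x := (con 1ℚ :+ n) :* x) refl x (↑ n) ⟩
  (1ℚ + ↑ n) * x        ≡⟨ cong (_* x) (↑-+ 1 n) ⟨
  ↑ suc n * x           ∎
  where open ≡-Reasoning

sum-zero : ∀ n {f : Vector ℚ n} → (∀ i → f i ≡ 0ℚ) → sum f ≡ 0ℚ
sum-zero n f≡0 = trans (sum-cong-≗ f≡0) (trans (sum-replicate-↑ n 0ℚ) (*-zeroʳ (↑ n)))

sum-identity : ∀ {n} (i : Fin n) (f : Vector ℚ n) → sum (λ k → identity i k * f k) ≡ f i
sum-identity {suc n} zero    f = begin
  1ℚ * f zero + sum (λ k → 0ℚ * f (suc k)) ≡⟨ cong (1ℚ * f zero ℚ.+_) (sum-zero n λ k → *-zeroˡ (f (suc k))) ⟩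
  1ℚ * f zero + 0ℚ                         ≡⟨ +-identityʳ _ ⟩
  1ℚ * f zero                              ≡⟨ *-identityˡ _ ⟩
  f zero                                   ∎
  where open ≡-Reasoning
sum-identity {suc n} (suc i) f = begin
  0ℚ * f zero + sum (λ k → identity i k * f (suc k))
      ≡⟨ cong₂ _+_ (*-zeroˡ (f zero)) (sum-identity i (f ∘ suc)) ⟩
  0ℚ + f (suc i)                                     ≡⟨ +-identityˡ _ ⟩
  f (suc i)                                          ∎
  where open ≡-Reasoning

rotation : Permutation (suc p) (suc p)
rotation = permutation next prev next-prev prev-next

sum-next : (f : Vector ℚ (suc p)) → sum (f ∘ next) ≡ sum f
sum-next f = sym (sum-permute f rotation)

sum-prev : (f : Vector ℚ (suc p)) → sum (f ∘ prev) ≡ sum f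
sum-prev f = trans (sym (sum-next (f ∘ prev))) (sum-cong-≗ (cong f ∘ prev-next))

-- The operator `N` and the rim block of `E`

N : Vector ℚ (suc p) → Vector ℚ (suc p)
N f i = f i + f (next i) + f (prev i)

sum-+₃ : ∀ {n} (f g h : Vector ℚ n) → sum (λ k → f k + g k + h k) ≡ sum f + sum g + sum h
sum-+₃ f g h = trans (∑-distrib-+ (λ k → f k + g k) h) (cong (_+ sum h) (∑-distrib-+ f g))

sum-N : (f : Vector ℚ (suc p)) → sum (N f) ≡ ↑ 3 * sum f
sum-N f = begin
  sum (N f)                                   ≡⟨ sum-+₃ f (f ∘ next) (f ∘ prev) ⟩
  sum f + sum (f ∘ next) + sum (f ∘ prev)     ≡⟨ cong₂ (λ x y → sum f + x + y) (sum-next f) (sum-prev f) ⟩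
  sum f + sum f + sum f                       ≡⟨ solve 1 (λ s → s :+ s :+ s := con (↑ 3) :* s) refl (sum f) ⟩
  ↑ 3 * sum f                                 ∎
  where open ≡-Reasoning

-- Rotation permutes the indices, so reindexing each sum moves `next` off `g` and onto `f` as
-- `prev`, and conversely.
N-selfAdjoint : (f g : Vector ℚ (suc p)) → sum (λ k → f k * N g k) ≡ sum (λ k → N f k * g k)
N-selfAdjoint f g = begin
  sum (λ k → f k * N g k)
    ≡⟨ sum-cong-≗ (λ k → solve 4 (λ a x y z → a :* (x :+ y :+ z) := a :* x :+ a :* y :+ a :* z) refl (f k)
        (g k) (g (next k)) (g (prev k))) ⟩
  sum (λ k → f k * g k + f k * g (next k) + f k * g (prev k))
    ≡⟨ sum-+₃ (λ k → f k * g k) (λ k → f k * g (next k)) (λ k → f k * g (prev k)) ⟩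
  A + sum (λ k → f k * g (next k)) + sum (λ k → f k * g (prev k))
    ≡⟨ cong₂ (λ x y → A + x + y)
         (trans (sym (sum-prev (λ k → f k * g (next k))))
             (sum-cong-≗ λ k → cong (λ i → f (prev k) * g i) (next-prev k)))
         (trans (sym (sum-next (λ k → f k * g (prev k))))
             (sum-cong-≗ λ k → cong (λ i → f (next k) * g i) (prev-next k))) ⟩
  A + sum (λ k → f (prev k) * g k) + sum (λ k → f (next k) * g k)
    ≡⟨ sum-+₃ (λ k → f k * g k) (λ k → f (prev k) * g k) (λ k → f (next k) * g k) ⟨
  sum (λ k → f k * g k + f (prev k) * g k + f (next k) * g k)
    ≡⟨ sum-cong-≗ (λ k → solve 4 (λ a x y z → x :* a :+ z :* a :+ y :* a := (x :+ y :+ z) :* a) refl (g k)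
        (f k) (f (next k)) (f (prev k))) ⟩
  sum (λ k → N f k * g k) ∎
  where
  open ≡-Reasoning
  A = sum (λ k → f k * g k)

N-cong : {f g : Vector ℚ (suc p)} → (∀ i → f i ≡ g i) → ∀ i → N f i ≡ N g i
N-cong f≗g i = cong₂ _+_ (cong₂ _+_ (f≗g i) (f≗g (next i))) (f≗g (prev i))

-- In a circulant, moving the row index one way amounts to moving the column index the other way, so
-- `N` sees the same three entries along a column as along a row.
N-circulant : {A : Matrix ℚ (suc p) (suc p)} → Circulant A → ∀ i j → N (λ k → A k j) i ≡ N (A i) j
N-circulant {A = A} circ i j = begin
  A i j + A (next i) j + A (prev i) j ≡⟨ cong₂ (λ x y → A i j + x + y) (circulant-nextˡ circ i j)
      (circulant-prevˡ circ i j) ⟩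
  A i j + A i (prev j) + A i (next j) ≡⟨ solve 3 (λ x y z → x :+ y :+ z := x :+ z :+ y) refl (A i j)
      (A i (prev j)) (A i (next j)) ⟩
  A i j + A i (next j) + A i (prev j) ∎
  where open ≡-Reasoning

↑3-cancel : ∀ {x y} → ↑ 3 * x ≡ ↑ 3 * y → x ≡ y
↑3-cancel {x} {y} eq = begin
  x                           ≡⟨ solve 1 (λ x → x := con (+ 1 ℚ./ 3) :* (con (↑ 3) :* x)) refl x ⟩
  (+ 1 ℚ./ 3) * (↑ 3 * x)     ≡⟨ cong ((+ 1 ℚ./ 3) ℚ.*_) eq ⟩
  (+ 1 ℚ./ 3) * (↑ 3 * y)     ≡⟨ solve 1 (λ x → x := con (+ 1 ℚ./ 3) :* (con (↑ 3) :* x)) refl y ⟨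
  y                           ∎
  where open ≡-Reasoning

-- `N` acts on vectors; its matrix is obtained by applying it to the rows of the identity.
rimBlock : Matrix ℚ (suc p) (suc p)
rimBlock i j = ↑ 2 - ↑ 2 * N (identity i) j

rimBlock-sym : (i j : Fin (suc p)) → rimBlock i j ≡ rimBlock j i
rimBlock-sym i j = cong (λ x → ↑ 2 - ↑ 2 * x) (begin
  N (identity i) j             ≡⟨ N-cong (identity-sym i) j ⟩
  N (λ k → identity k i) j     ≡⟨ N-circulant identity-circulant j i ⟩
  N (identity j) i             ∎)
  where open ≡-Reasoning

rimBlock-sum : ∀ (f : Vector ℚ (suc p)) i → sum (λ k → rimBlock i k * f k) ≡ ↑ 2 * sum f - ↑ 2 * N f i
rimBlock-sum f i = begin
  sum (λ k → rimBlock i k * f k)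
    ≡⟨ sum-cong-≗ (λ k → solve 2 (λ x y → (con (↑ 2) :- con (↑ 2) :* x) :* y := con (↑ 2) :* y
        :+ con (- ↑ 2) :* (x :* y)) refl (N (identity i) k) (f k)) ⟩
  sum (λ k → ↑ 2 * f k + - ↑ 2 * (N (identity i) k * f k))
    ≡⟨ ∑-distrib-+ (λ k → ↑ 2 * f k) (λ k → - ↑ 2 * (N (identity i) k * f k)) ⟩
  sum (λ k → ↑ 2 * f k) + sum (λ k → - ↑ 2 * (N (identity i) k * f k))
    ≡⟨ cong₂ _+_ (*-distribˡ-sum (↑ 2) f) (*-distribˡ-sum (- ↑ 2) (λ k → N (identity i) k * f k)) ⟨
  ↑ 2 * sum f + - ↑ 2 * sum (λ k → N (identity i) k * f k)
    ≡⟨ cong (λ x → ↑ 2 * sum f + - ↑ 2 * x)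
        (trans (sym (N-selfAdjoint (identity i) f)) (sum-identity i (N f))) ⟩
  ↑ 2 * sum f + - ↑ 2 * N f i
    ≡⟨ solve 2 (λ s x → con (↑ 2) :* s :+ con (- ↑ 2) :* x := con (↑ 2) :* s :- con (↑ 2) :* x) refl
        (sum f) (N f i) ⟩
  ↑ 2 * sum f - ↑ 2 * N f i ∎
  where open ≡-Reasoning

rimBlock-sumʳ : ∀ (f : Vector ℚ (suc p)) j → sum (λ k → f k * rimBlock k j) ≡ ↑ 2 * sum f - ↑ 2 * N f j
rimBlock-sumʳ f j = trans
  (sum-cong-≗ (λ k → trans (*-comm (f k) (rimBlock k j)) (cong (_* f k) (rimBlock-sym k j))))
  (rimBlock-sum f j)

-- The Penrose equations for the block matrices, from the relations between `N`, `T`, `Y` and `Z`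

module _ (ρ : ℚ) (m*ρ≡1 : ↑ suc p * ρ ≡ 1ℚ)
  (T Y Z : Matrix ℚ (suc p) (suc p))
  (T-sym : ∀ i j → T i j ≡ T j i) (T-circ : Circulant T)
  (Y-circ : Circulant Y)
  (NT : ∀ i j → N (λ k → T k j) i ≡ ↑ 3 * ρ)
  (NY : ∀ i j → N (λ k → Y k j) i ≡ ½ * (T i j - identity i j))
  (NZ : ∀ i j → N (λ k → Z k j) i ≡ Y i j)
  where
  open ≡-Reasoning

  private
    m : ℕ
    m = suc p

    a : ℚ
    a = ρ * (↑ 6 - ↑ 2 * ↑ m)

    wheelMatrix inverse projection : Matrix ℚ (suc m) (suc m)
    wheelMatrix = block 0ℚ (replicate m 1ℚ) (replicate m 1ℚ) rimBlock
    inverse = block a (replicate m ρ) (replicate m ρ) Y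

    Q : Matrix ℚ m m
    Q i j = identity i j - T i j + ρ

    projection = block 1ℚ (replicate m 0ℚ) (replicate m 0ℚ) Q

    N-rowT : ∀ i j → N (T i) j ≡ ↑ 3 * ρ
    N-rowT i j = trans (sym (N-circulant T-circ i j)) (NT i j)

    N-rowY : ∀ i j → N (Y i) j ≡ ½ * (T i j - identity i j)
    N-rowY i j = trans (sym (N-circulant Y-circ i j)) (NY i j)

    -- `N` triples the sum of a vector, so row and column sums of `T`, `Y` and `Z` are read off from
    -- their images under `N`.
    sum-rowT : ∀ i → sum (T i) ≡ 1ℚ
    sum-rowT i = ↑3-cancel (begin
      ↑ 3 * sum (T i)             ≡⟨ sum-N (T i) ⟨
      sum (N (T i))               ≡⟨ sum-cong-≗ (N-rowT i) ⟩
      sum {m} (λ _ → ↑ 3 * ρ)     ≡⟨ sum-replicate-↑ m (↑ 3 * ρ) ⟩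
      ↑ m * (↑ 3 * ρ)             ≡⟨ solve 2 (λ m r → m :* (con (↑ 3) :* r) := con (↑ 3) :* (m :* r)) refl
          (↑ m) ρ ⟩
      ↑ 3 * (↑ m * ρ)             ≡⟨ cong (↑ 3 ℚ.*_) m*ρ≡1 ⟩
      ↑ 3 * 1ℚ                    ∎)

    sum-rowI : ∀ {n} (i : Fin n) → sum (identity i) ≡ 1ℚ
    sum-rowI i = trans (sum-cong-≗ λ k → sym (*-identityʳ (identity i k))) (sum-identity i (λ _ → 1ℚ))

    sum-T-I : ∀ i → sum (λ k → ½ * (T i k - identity i k)) ≡ 0ℚ
    sum-T-I i = begin
      sum (λ k → ½ * (T i k - identity i k))
        ≡⟨ sum-cong-≗ (λ k → solve 2 (λ t x → con ½ :* (t :- x) := con ½ :* t :+ con (- ½) :* x) refl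
            (T i k) (identity i k)) ⟩
      sum (λ k → ½ * T i k + - ½ * identity i k)
        ≡⟨ ∑-distrib-+ (λ k → ½ * T i k) (λ k → - ½ * identity i k) ⟩
      sum (λ k → ½ * T i k) + sum (λ k → - ½ * identity i k)
        ≡⟨ cong₂ _+_ (*-distribˡ-sum ½ (T i)) (*-distribˡ-sum (- ½) (identity i)) ⟨
      ½ * sum (T i) + - ½ * sum (identity i)
        ≡⟨ cong₂ (λ x y → ½ * x + - ½ * y) (sum-rowT i) (sum-rowI i) ⟩
      0ℚ ∎

    sum-rowY : ∀ i → sum (Y i) ≡ 0ℚ
    sum-rowY i = ↑3-cancel (begin
      ↑ 3 * sum (Y i)                           ≡⟨ sum-N (Y i) ⟨
      sum (N (Y i))                             ≡⟨ sum-cong-≗ (N-rowY i) ⟩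
      sum (λ k → ½ * (T i k - identity i k))    ≡⟨ sum-T-I i ⟩
      ↑ 3 * 0ℚ                                  ∎)

    sum-colY : ∀ j → sum (λ k → Y k j) ≡ 0ℚ
    sum-colY j = ↑3-cancel (begin
      ↑ 3 * sum (λ k → Y k j)                   ≡⟨ sum-N (λ k → Y k j) ⟨
      sum (N (λ k → Y k j))                     ≡⟨ sum-cong-≗ (λ k → NY k j) ⟩
      sum (λ k → ½ * (T k j - identity k j))
        ≡⟨ sum-cong-≗ (λ k → cong₂ (λ x y → ½ * (x - y)) (T-sym k j) (identity-sym k j)) ⟩
      sum (λ k → ½ * (T j k - identity j k))    ≡⟨ sum-T-I j ⟩
      ↑ 3 * 0ℚ                                  ∎)

    sum-colZ : ∀ j → sum (λ k → Z k j) ≡ 0ℚ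
    sum-colZ j = ↑3-cancel (begin
      ↑ 3 * sum (λ k → Z k j)    ≡⟨ sum-N (λ k → Z k j) ⟨
      sum (N (λ k → Z k j))      ≡⟨ sum-cong-≗ (λ k → NZ k j) ⟩
      sum (λ k → Y k j)          ≡⟨ sum-colY j ⟩
      ↑ 3 * 0ℚ                   ∎)

    -- N is self-adjoint, so it can be moved from Z to the rows of T, on which it is constant.
    T*Y≡0 : ∀ i j → sum (λ k → T i k * Y k j) ≡ 0ℚ
    T*Y≡0 i j = begin
      sum (λ k → T i k * Y k j)                 ≡⟨ sum-cong-≗ (λ k → cong (T i k ℚ.*_) (NZ k j)) ⟨
      sum (λ k → T i k * N (λ l → Z l j) k)     ≡⟨ N-selfAdjoint (T i) (λ l → Z l j) ⟩
      sum (λ k → N (T i) k * Z k j)             ≡⟨ sum-cong-≗ (λ k → cong (_* Z k j) (N-rowT i k)) ⟩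
      sum (λ k → ↑ 3 * ρ * Z k j)               ≡⟨ *-distribˡ-sum (↑ 3 * ρ) (λ k → Z k j) ⟨
      ↑ 3 * ρ * sum (λ k → Z k j)               ≡⟨ cong (↑ 3 * ρ ℚ.*_) (sum-colZ j) ⟩
      ↑ 3 * ρ * 0ℚ                              ≡⟨ *-zeroʳ (↑ 3 * ρ) ⟩
      0ℚ                                        ∎

    sum-constρ : sum {m} (λ _ → ρ) ≡ 1ℚ
    sum-constρ = trans (sum-replicate-↑ m ρ) m*ρ≡1

    sum-Q* : ∀ i (f : Vector ℚ m) → sum (λ k → Q i k * f k) ≡ f i - sum (λ k → T i k * f k) + ρ * sum f
    sum-Q* i f = begin
      sum (λ k → Q i k * f k)
        ≡⟨ sum-cong-≗ (λ k → solve 4 (λ x t r f → (x :- t :+ r) :* f := x :* f :+ con (- 1ℚ) :* (t :* f)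
            :+ r :* f) refl (identity i k) (T i k) ρ (f k)) ⟩
      sum (λ k → identity i k * f k + - 1ℚ * (T i k * f k) + ρ * f k)
        ≡⟨ sum-+₃ (λ k → identity i k * f k) (λ k → - 1ℚ * (T i k * f k)) (λ k → ρ * f k) ⟩
      sum (λ k → identity i k * f k) + sum (λ k → - 1ℚ * (T i k * f k)) + sum (λ k → ρ * f k)
        ≡⟨ cong₂ _+_ (cong₂ _+_ (sum-identity i f) (sym (*-distribˡ-sum (- 1ℚ) (λ k → T i k * f k))))
            (sym (*-distribˡ-sum ρ f)) ⟩
      f i + - 1ℚ * sum (λ k → T i k * f k) + ρ * sum f
        ≡⟨ solve 3 (λ x t s → x :+ con (- 1ℚ) :* t :+ s := x :- t :+ s) refl (f i) _ (ρ * sum f) ⟩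
      f i - sum (λ k → T i k * f k) + ρ * sum f ∎

    sum-rowQ : ∀ i → sum (λ k → Q i k * 1ℚ) ≡ 1ℚ
    sum-rowQ i = begin
      sum (λ k → Q i k * 1ℚ)                                  ≡⟨ sum-Q* i (λ _ → 1ℚ) ⟩
      1ℚ - sum (λ k → T i k * 1ℚ) + ρ * sum {m} (λ _ → 1ℚ)
        ≡⟨ cong₂ (λ x y → 1ℚ - x + ρ * y)
             (trans (sum-cong-≗ (λ k → *-identityʳ (T i k))) (sum-rowT i)) (sum-replicate-↑ m 1ℚ) ⟩
      1ℚ - 1ℚ + ρ * (↑ m * 1ℚ)
          ≡⟨ solve 2 (λ r m → con 1ℚ :- con 1ℚ :+ r :* (m :* con 1ℚ) := m :* r) refl ρ (↑ m) ⟩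
      ↑ m * ρ                                                 ≡⟨ m*ρ≡1 ⟩
      1ℚ                                                      ∎

    -- `T` and the constant matrix `ρJ` have the same image under `N`, so they cancel in
    -- `Q = I - T + ρJ`. Hence multiplying by `Q` does not change the rim block.
    N-rowQ : ∀ i j → N (Q i) j ≡ N (identity i) j
    N-rowQ i j = begin
      N (Q i) j
        ≡⟨ solve 7 (λ x y z s t u r → (x :- s :+ r) :+ (y :- t :+ r) :+ (z :- u :+ r) :=
             x :+ y :+ z :- (s :+ t :+ u) :+ con (↑ 3) :* r) refl
             (identity i j) (identity i (next j)) (identity i (prev j)) (T i j) (T i (next j))
                 (T i (prev j)) ρ ⟩
      N (identity i) j - N (T i) j + ↑ 3 * ρ
        ≡⟨ cong (λ x → N (identity i) j - x + ↑ 3 * ρ) (N-rowT i j) ⟩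
      N (identity i) j - ↑ 3 * ρ + ↑ 3 * ρ
        ≡⟨ solve 2 (λ x y → x :- y :+ y := x) refl (N (identity i) j) (↑ 3 * ρ) ⟩
      N (identity i) j ∎

    collapse₀ : ∀ x y → 0ℚ * x + y ≡ y
    collapse₀ = solve 2 (λ x y → con 0ℚ :* x :+ y := y) refl

    head-only : ∀ x (f : Vector ℚ m) → 1ℚ * x + sum (λ k → 0ℚ * f k) ≡ x
    head-only x f = trans (cong (1ℚ * x ℚ.+_) (sum-zero m (λ k → *-zeroˡ (f k))))
                          (solve 1 (λ x → con 1ℚ :* x :+ con 0ℚ := x) refl x)

    -- Origin of the corner `a`: a rim row of `E` times the hub column of `X` is `a + 2 - 6ρ`. It
    -- has to vanish, and by `mρ = 1` this means `a = ρ(6 - 2m)`.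
    border : 1ℚ * a + (↑ 2 * 1ℚ - ↑ 2 * (ρ + ρ + ρ)) ≡ 0ℚ
    border = begin
      1ℚ * a + (↑ 2 * 1ℚ - ↑ 2 * (ρ + ρ + ρ))
        ≡⟨ solve 2 (λ m r → con 1ℚ :* (r :* (con (↑ 6) :- con (↑ 2) :* m))
            :+ (con (↑ 2) :* con 1ℚ :- con (↑ 2) :* (r :+ r :+ r))
             := con (↑ 2) :- con (↑ 2) :* (m :* r)) refl (↑ m) ρ ⟩
      ↑ 2 - ↑ 2 * (↑ m * ρ)
        ≡⟨ cong (λ x → ↑ 2 - ↑ 2 * x) m*ρ≡1 ⟩
      0ℚ ∎

    corner : ∀ s {u} t x → s ≡ 0ℚ → u ≡ ½ * (t - x) → 1ℚ * ρ + (↑ 2 * s - ↑ 2 * u) ≡ x - t + ρ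
    corner s t x refl refl = solve 3 (λ r t x →
      con 1ℚ :* r :+ (con (↑ 2) :* con 0ℚ :- con (↑ 2) :* (con ½ :* (t :- x))) := x :- t :+ r) refl ρ t x

    E*X : wheelMatrix *ᴹ inverse ≈ᴹ projection
    E*X zero    zero    = trans (collapse₀ a _) (trans (sum-cong-≗ {m} (λ k → *-identityˡ ρ)) sum-constρ)
    E*X zero    (suc j) = trans (collapse₀ ρ _) (trans (sum-cong-≗ (λ k → *-identityˡ (Y k j))) (sum-colY j))
    E*X (suc i) zero    = trans (cong (1ℚ * a ℚ.+_)
        (trans (rimBlock-sum (λ _ → ρ) i) (cong (λ s → ↑ 2 * s - ↑ 2 * (ρ + ρ + ρ)) sum-constρ))) border
    E*X (suc i) (suc j) = trans (cong (1ℚ * ρ ℚ.+_) (rimBlock-sum (λ k → Y k j) i))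
                                (corner _ (T i j) (identity i j) (sum-colY j) (NY i j))

    X*E : inverse *ᴹ wheelMatrix ≈ᴹ projection
    X*E zero    zero    = trans (cong (_+ sum {m} (λ _ → ρ * 1ℚ)) (*-zeroʳ a))
        (trans (+-identityˡ _) (trans (sum-cong-≗ {m} (λ k → *-identityʳ ρ)) sum-constρ))
    X*E zero    (suc j) = trans (cong₂ _+_ (*-comm a 1ℚ)
        (trans (rimBlock-sumʳ (λ _ → ρ) j) (cong (λ s → ↑ 2 * s - ↑ 2 * (ρ + ρ + ρ)) sum-constρ))) border
    X*E (suc i) zero    = trans (cong (_+ sum (λ k → Y i k * 1ℚ)) (*-zeroʳ ρ))
        (trans (+-identityˡ _) (trans (sum-cong-≗ (λ k → *-identityʳ (Y i k))) (sum-rowY i)))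
    X*E (suc i) (suc j) = trans (cong₂ _+_ (*-comm ρ 1ℚ) (rimBlock-sumʳ (Y i) j))
                                (corner _ (T i j) (identity i j) (sum-rowY i) (N-rowY i j))

    projection*E : projection *ᴹ wheelMatrix ≈ᴹ wheelMatrix
    projection*E zero    zero    = head-only 0ℚ (λ _ → 1ℚ)
    projection*E zero    (suc j) = head-only 1ℚ (λ k → rimBlock k j)
    projection*E (suc i) zero    = trans (collapse₀ 0ℚ _) (sum-rowQ i)
    projection*E (suc i) (suc j) = trans (collapse₀ 1ℚ _) (trans (rimBlock-sumʳ (Q i) j)
      (cong₂ (λ x y → ↑ 2 * x - ↑ 2 * y) (trans (sum-cong-≗ (λ k → sym (*-identityʳ (Q i k))))
          (sum-rowQ i)) (N-rowQ i j)))

    projection*X : projection *ᴹ inverse ≈ᴹ inverse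
    projection*X zero    zero    = head-only a (λ _ → ρ)
    projection*X zero    (suc j) = head-only ρ (λ k → Y k j)
    projection*X (suc i) zero    = trans (collapse₀ a _) (begin
      sum (λ k → Q i k * ρ)             ≡⟨ sum-cong-≗ (λ k → cong (_* ρ) (*-identityʳ (Q i k))) ⟨
      sum (λ k → Q i k * 1ℚ * ρ)        ≡⟨ *-distribʳ-sum ρ (λ k → Q i k * 1ℚ) ⟨
      sum (λ k → Q i k * 1ℚ) * ρ        ≡⟨ cong (_* ρ) (sum-rowQ i) ⟩
      1ℚ * ρ                            ≡⟨ *-identityˡ ρ ⟩
      ρ                                 ∎)
    projection*X (suc i) (suc j) = trans (collapse₀ ρ _) (begin
      sum (λ k → Q i k * Y k j)         ≡⟨ sum-Q* i (λ k → Y k j) ⟩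
      Y i j - sum (λ k → T i k * Y k j) + ρ * sum (λ k → Y k j)
        ≡⟨ cong₂ (λ x y → Y i j - x + ρ * y) (T*Y≡0 i j) (sum-colY j) ⟩
      Y i j - 0ℚ + ρ * 0ℚ               ≡⟨ solve 2 (λ y r → y :- con 0ℚ :+ r :* con 0ℚ := y) refl (Y i j) ρ ⟩
      Y i j                             ∎)

    projection-sym : transpose projection ≈ᴹ projection
    projection-sym zero    zero    = refl
    projection-sym zero    (suc j) = refl
    projection-sym (suc i) zero    = refl
    projection-sym (suc i) (suc j) = cong₂ (λ x y → x - y + ρ) (identity-sym j i) (T-sym j i)

  penrose-block : PenroseEquations
    (block 0ℚ (replicate m 1ℚ) (replicate m 1ℚ) rimBlock)
    (block (ρ * (↑ 6 - ↑ 2 * ↑ m)) (replicate m ρ) (replicate m ρ) Y)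
  penrose-block = record
    { AXA≈A  = λ i j → trans (sum-cong-≗ (λ k → cong (_* wheelMatrix k j) (E*X i k))) (projection*E i j)
    ; XAX≈X  = λ i j → trans (sum-cong-≗ (λ k → cong (_* inverse k j) (X*E i k))) (projection*X i j)
    ; AX-sym = λ i j → trans (E*X j i) (trans (projection-sym i j) (sym (E*X i j)))
    ; XA-sym = λ i j → trans (X*E j i) (trans (projection-sym i j) (sym (X*E i j)))
    }

-- The eccentricity matrix of the wheel

Next-next : (i : Fin (suc p)) → Next i (next i)
Next-next {p} i with view i
... | ‵fromℕ     = inj₂ (cong suc (toℕ-fromℕ p) , refl)
... | ‵inject₁ j = inj₁ (cong suc (toℕ-inject₁ j))

Next-functional : {i j k : Fin p} → Next i j → Next i k → j ≡ k
Next-functional         (inj₁ e)       (inj₁ e′)        = toℕ-injective (trans (sym e) e′)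
Next-functional {j = j} (inj₁ e)       (inj₂ (e′ , _))  = contradiction (trans (sym e) e′) (ℕ.<⇒≢ (toℕ<n j))
Next-functional {k = k} (inj₂ (e , _)) (inj₁ e′)        = contradiction (trans (sym e′) e) (ℕ.<⇒≢ (toℕ<n k))
Next-functional         (inj₂ (_ , e)) (inj₂ (_ , e′))  = toℕ-injective (trans e (sym e′))

Next⇒≡ : {i j : Fin (suc p)} → Next i j → next i ≡ j
Next⇒≡ {i = i} = Next-functional (Next-next i)

Next-prev : (i : Fin (suc p)) → Next (prev i) i
Next-prev i = subst (Next (prev i)) (next-prev i) (Next-next (prev i))

Next⇒prev≡ : {i j : Fin (suc p)} → Next j i → prev i ≡ j
Next⇒prev≡ {j = j} nx = trans (cong prev (sym (Next⇒≡ nx))) (prev-next j)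

-- On a cycle of length two both neighbours of a vertex coincide. From length three on, `i`,
-- `next i` and `prev i` are distinct, so the three terms of `N (identity i)` never overlap.
Next-asym : 3 ≤ p → {i j : Fin p} → Next i j → ¬ Next j i
Next-asym _ (inj₁ e) (inj₁ e′) = ℕ.<⇒≢ (ℕ.m≤n+m _ 1) (trans (sym e′) (cong suc (sym e)))
Next-asym 3≤p (inj₁ e) (inj₂ (e′ , z)) =
  ℕ.<⇒≢ 3≤p (trans (cong (2 ℕ.+_) (sym z)) (trans (cong suc e) e′))
Next-asym 3≤p (inj₂ (e , z)) (inj₁ e′) =
  ℕ.<⇒≢ 3≤p (trans (cong (2 ℕ.+_) (sym z)) (trans (cong suc e′) e))
Next-asym 3≤p (inj₂ (e , _)) (inj₂ (_ , z′)) =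
  ℕ.<⇒≢ (ℕ.≤-trans (ℕ.n≤1+n 2) 3≤p) (trans (cong suc (sym z′)) e)

prev≢ : 3 ≤ suc p → (i : Fin (suc p)) → prev i ≢ i
prev≢ 3≤ i eq = next-irrefl 3≤ i (subst (λ k → Next k i) eq (Next-prev i))

next≢ : 3 ≤ suc p → (i : Fin (suc p)) → next i ≢ i
next≢ 3≤ i eq = next-irrefl 3≤ i (subst (Next i) eq (Next-next i))

next≢prev : 3 ≤ suc p → (i : Fin (suc p)) → next i ≢ prev i
next≢prev 3≤ i eq = Next-asym 3≤ (Next-next i) (subst (λ k → Next k i) (sym eq) (Next-prev i))

least-≤ : ∀ {P : ℕ → Set} (P? : Decidable P) b → least P? b ≤ b
least-≤ P? zero    = z≤n
least-≤ P? (suc b) with does (P? 0)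
... | true  = z≤n
... | false = s≤s (least-≤ (P? ∘ suc) b)

foldr-⊔-≤ : ∀ {n} {b} (f : Vector ℕ n) → (∀ i → f i ≤ b) → Vector.foldr _⊔_ 0 f ≤ b
foldr-⊔-≤ {zero}  f f≤b = z≤n
foldr-⊔-≤ {suc n} f f≤b = ℕ.⊔-lub (f≤b zero) (foldr-⊔-≤ (f ∘ suc) (f≤b ∘ suc))

≤-foldr-⊔ : ∀ {n} (f : Vector ℕ n) i → f i ≤ Vector.foldr _⊔_ 0 f
≤-foldr-⊔ f zero    = ℕ.m≤m⊔n _ _
≤-foldr-⊔ f (suc i) = ℕ.≤-trans (≤-foldr-⊔ (f ∘ suc) i) (ℕ.m≤n⊔m (f zero) _)

foldr-⊔-attained : ∀ {n} {b} (f : Vector ℕ n) → (∀ i → f i ≤ b) → ∀ i → f i ≡ b →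
                   Vector.foldr _⊔_ 0 f ≡ b
foldr-⊔-attained f f≤b i refl = ℕ.≤-antisym (foldr-⊔-≤ f f≤b) (≤-foldr-⊔ f i)

module _ (p : ℕ) (n≥10 : 10 ≤ suc (suc p)) where
  private
    m : ℕ
    m = suc p

    3≤m : 3 ≤ m
    3≤m = 10≤1+m⇒3≤m n≥10

    G : ConnectedGraph (suc m)
    G = wheel m 3≤m

  Adjacent : Fin m → Fin m → Set
  Adjacent i j = Next i j ⊎ Next j i

  private
    dist-adj : ∀ {i j} → i ≢ j → Adjacent i j → dist G (suc i) (suc j) ≡ 1
    dist-adj {i} {j} i≢j adj
      rewrite dec-false (walk? wheelAdj? (suc i) (suc j) 0) (λ { refl → i≢j refl })
            | dec-true (walk? wheelAdj? (suc i) (suc j) 1) (suc j , adj , refl) = refl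

    -- The walk through the hub bounds the search by 2, so 2 is returned as soon as lengths 0 and 1
    -- fail.
    dist-far : ∀ {i j} → i ≢ j → ¬ Adjacent i j → dist G (suc i) (suc j) ≡ 2
    dist-far {i} {j} i≢j ¬adj
      rewrite dec-false (walk? wheelAdj? (suc i) (suc j) 0) (λ { refl → i≢j refl })
            | dec-false (walk? wheelAdj? (suc i) (suc j) 1) (λ { (_ , adj , refl) → ¬adj adj }) = refl

    dist-self : ∀ i → dist G (suc i) (suc i) ≡ 0
    dist-self i rewrite dec-true (walk? wheelAdj? (suc i) (suc i) 0) refl = refl

    -- The witness is the rim vertex of index `suc k`. It is neither the first nor, since
    -- `k + 3 ≤ 9 ≤ m`, the last one, so its neighbours have indices `k` and `suc (suc k)`, with no
    -- wrap-around.
    avoid : ∀ k → suc (suc (suc k)) ≤ 9 → ∀ i → toℕ i ≢ suc k → toℕ i ≢ k → toℕ i ≢ suc (suc k) →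
            ∃[ j ] (i ≢ j × ¬ Adjacent i j)
    avoid k k+3≤9 i i≢j 1+i≢j i≢1+j = j , (λ { refl → i≢j j-val }) ,
      λ { (inj₁ (inj₁ e))       → 1+i≢j (ℕ.suc-injective (trans e j-val))
        ; (inj₁ (inj₂ (_ , z))) → contradiction (trans (sym z) j-val) λ ()
        ; (inj₂ (inj₁ e))       → i≢1+j (trans (sym e) (cong suc j-val))
        ; (inj₂ (inj₂ (e , _))) → ℕ.<⇒≢ k+3≤m (trans (cong suc (sym j-val)) e)
        }
      where
      k+3≤m : suc (suc (suc k)) ≤ m
      k+3≤m = ℕ.≤-trans k+3≤9 (ℕ.s≤s⁻¹ n≥10)

      1+k<m : suc k < m
      1+k<m = ℕ.≤-trans (ℕ.n≤1+n (suc (suc k))) k+3≤m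

      j : Fin m
      j = fromℕ< 1+k<m

      j-val : toℕ j ≡ suc k
      j-val = toℕ-fromℕ< 1+k<m

    far : ∀ i → ∃[ j ] (i ≢ j × ¬ Adjacent i j)
    far i with toℕ i ℕ.≤? 3
    -- Indices up to 3 are far from the vertex of index 5, all others from the vertex of index 1.
    ... | yes i≤3 = avoid 4 (ℕ.m≤m+n 7 2) i (ℕ.<⇒≢ (ℕ.≤-trans (s≤s i≤3) (ℕ.m≤m+n 4 1)))
                      (ℕ.<⇒≢ (s≤s i≤3)) (ℕ.<⇒≢ (ℕ.≤-trans (s≤s i≤3) (ℕ.m≤m+n 4 2)))
    ... | no  i≰3 = avoid 0 (ℕ.m≤m+n 3 6) i (ℕ.>⇒≢ (ℕ.≤-trans (ℕ.m≤m+n 2 2) (ℕ.≰⇒> i≰3)))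
                      (ℕ.>⇒≢ (ℕ.≤-trans (ℕ.m≤m+n 1 3) (ℕ.≰⇒> i≰3)))
                          (ℕ.>⇒≢ (ℕ.≤-trans (ℕ.m≤m+n 3 1) (ℕ.≰⇒> i≰3)))

    dist-≤2 : ∀ i v → dist G (suc i) v ≤ 2
    dist-≤2 i zero    = ℕ.≤-trans (least-≤ (walk? wheelAdj? (suc i) zero) 1) (ℕ.n≤1+n 1)
    dist-≤2 i (suc j) = least-≤ (walk? wheelAdj? (suc i) (suc j)) 2

    dist-hub-≤1 : ∀ v → dist G zero v ≤ 1
    dist-hub-≤1 zero    = z≤n
    dist-hub-≤1 (suc j) = least-≤ (walk? wheelAdj? zero (suc j)) 1

    ecc-hub : ecc G zero ≡ 1
    ecc-hub = foldr-⊔-attained (dist G zero) dist-hub-≤1 (suc zero) refl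

    ecc-rim : ∀ i → ecc G (suc i) ≡ 2
    ecc-rim i with j , i≢j , ¬adj ← far i =
      foldr-⊔-attained (dist G (suc i)) (dist-≤2 i) (suc j) (dist-far i≢j ¬adj)

    eccMatrix-rim : ∀ (i j : Fin m) {d} → dist G (suc i) (suc j) ≡ d →
                    eccMatrix G (suc i) (suc j) ≡ (if does (d ℕ.≟ 2) then d else 0)
    eccMatrix-rim i j eq = cong₂ (λ d k → if does (d ℕ.≟ k) then d else 0) eq
                                 (cong₂ _⊓_ (ecc-rim i) (ecc-rim j))

    rimBlock-entry : ∀ (i j : Fin m) x y z → identity i j ≡ x → identity i (next j) ≡ y → identity i
        (prev j) ≡ z →
                 ↑ 2 ℚ.- ↑ 2 ℚ.* (x ℚ.+ y ℚ.+ z) ≡ rimBlock i j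
    rimBlock-entry i j _ _ _ refl refl refl = refl

    -- All rim vertices have eccentricity 2, so only distance 2 survives in the matrix; at distances
    -- 0 and 1 exactly one term of `N (identity i)` is 1, and `2 - 2·1 = 0`.
    E-rim : ∀ (i j : Fin m) → Dec (i ≡ j) → Dec (Next i j) → Dec (Next j i) →
            ↑ eccMatrix G (suc i) (suc j) ≡ rimBlock i j
    E-rim i _ (yes refl) _ _ = trans (cong ↑_ (eccMatrix-rim i i (dist-self i)))
            (rimBlock-entry i i 1ℚ 0ℚ 0ℚ (identity-≡ {i = i} refl) (identity-≢ (next≢ 3≤m i ∘ sym))
                (identity-≢ (prev≢ 3≤m i ∘ sym)))
    E-rim i j (no i≢j) (yes i→j) _ = trans (cong ↑_ (eccMatrix-rim i j (dist-adj i≢j (inj₁ i→j))))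
            (rimBlock-entry i j 0ℚ 0ℚ 1ℚ (identity-≢ i≢j)
              (identity-≢ λ i≡nj → next≢prev 3≤m j (trans (sym i≡nj) (sym (Next⇒prev≡ i→j))))
              (identity-≡ (sym (Next⇒prev≡ i→j))))
    E-rim i j (no i≢j) (no i↛j) (yes j→i) = trans (cong ↑_ (eccMatrix-rim i j (dist-adj i≢j (inj₂ j→i))))
            (rimBlock-entry i j 0ℚ 1ℚ 0ℚ (identity-≢ i≢j) (identity-≡ (sym (Next⇒≡ j→i)))
              (identity-≢ λ i≡pj → i↛j (subst (λ k → Next k j) (sym i≡pj) (Next-prev j))))
    E-rim i j (no i≢j) (no i↛j) (no j↛i) = trans (cong ↑_ (eccMatrix-rim i j (dist-far i≢j [ i↛j , j↛i ])))
            (rimBlock-entry i j 0ℚ 0ℚ 0ℚ (identity-≢ i≢j)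
              (identity-≢ λ i≡nj → j↛i (subst (Next j) (sym i≡nj) (Next-next j)))
              (identity-≢ λ i≡pj → i↛j (subst (λ k → Next k j) (sym i≡pj) (Next-prev j))))

  E≗block : ∀ u v → E m n≥10 u v ≡ block 0ℚ (replicate m 1ℚ) (replicate m 1ℚ) rimBlock u v
  E≗block zero    zero    = cong (λ k → ↑ (if does (0 ℕ.≟ k) then 0 else 0)) (cong₂ _⊓_ ecc-hub ecc-hub)
  E≗block zero    (suc j) = cong (λ k → ↑ (if does (1 ℕ.≟ k) then 1 else 0)) (cong₂ _⊓_ ecc-hub (ecc-rim j))
  E≗block (suc i) zero    = cong (λ k → ↑ (if does (1 ℕ.≟ k) then 1 else 0)) (cong₂ _⊓_ (ecc-rim i) ecc-hub)
  E≗block (suc i) (suc j) = E-rim i j (i ≟ᶠ j) (next? i j) (next? j i)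

-- The vectors z₁ and z₂

-- Interleaves three sequences over the residue classes modulo 3. Shifting the sequences replaces
-- division, and `suc q ℕ.* 3` unfolds to three successors, which is why multiples have the 3 on the
-- right.
tri : ∀ {a} {A : Set a} → (f g h : ℕ → A) → ℕ → A
tri f g h 0                   = f 0
tri f g h 1                   = g 0
tri f g h 2                   = h 0
tri f g h (suc (suc (suc k))) = tri (f ∘ suc) (g ∘ suc) (h ∘ suc) k

module _ {a} {A : Set a} where
  tri-0 : ∀ (f g h : ℕ → A) q → tri f g h (q ℕ.* 3) ≡ f q
  tri-0 f g h zero    = refl
  tri-0 f g h (suc q) = tri-0 (f ∘ suc) (g ∘ suc) (h ∘ suc) q

  tri-1 : ∀ (f g h : ℕ → A) q → tri f g h (1 ℕ.+ q ℕ.* 3) ≡ g q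
  tri-1 f g h zero    = refl
  tri-1 f g h (suc q) = tri-1 (f ∘ suc) (g ∘ suc) (h ∘ suc) q

  tri-2 : ∀ (f g h : ℕ → A) q → tri f g h (2 ℕ.+ q ℕ.* 3) ≡ h q
  tri-2 f g h zero    = refl
  tri-2 f g h (suc q) = tri-2 (f ∘ suc) (g ∘ suc) (h ∘ suc) q

data Mod3 : ℕ → Set where
  0+ : ∀ q → Mod3 (q ℕ.* 3)
  1+ : ∀ q → Mod3 (1 ℕ.+ q ℕ.* 3)
  2+ : ∀ q → Mod3 (2 ℕ.+ q ℕ.* 3)

mod3 : ∀ k → Mod3 k
mod3 0 = 0+ 0
mod3 1 = 1+ 0
mod3 2 = 2+ 0
mod3 (suc (suc (suc k))) with mod3 k
... | 0+ q = 0+ (suc q)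
... | 1+ q = 1+ (suc q)
... | 2+ q = 2+ (suc q)

res : ℕ → Fin 3
res = tri (λ _ → 0F) (λ _ → 1F) (λ _ → 2F)

res-class : ∀ r q → res (toℕ r ℕ.+ q ℕ.* 3) ≡ r
res-class 0F = tri-0 _ _ _
res-class 1F = tri-1 _ _ _
res-class 2F = tri-2 _ _ _

-- `e i j` is by definition `δ (suc (toℕ j)) i`, and `δ` cancels a common successor by computation;
-- this takes 1-based indices to 0-based positions.
δ : ℕ → ℕ → ℚ
δ a b = if does (a ℕ.≟ b) then 1ℚ else 0ℚ

δ-≡ : ∀ {a b} → a ≡ b → δ a b ≡ 1ℚ
δ-≡ {a} {b} eq rewrite dec-true (a ℕ.≟ b) eq = refl

δ-≢ : ∀ {a b} → a ≢ b → δ a b ≡ 0ℚ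
δ-≢ {a} {b} neq rewrite dec-false (a ℕ.≟ b) neq = refl

δ-cong-⇔ : ∀ {a b a′ b′} → (a ≡ b → a′ ≡ b′) → (a′ ≡ b′ → a ≡ b) → δ a b ≡ δ a′ b′
δ-cong-⇔ {a} {b} {a′} {b′} to from with a ℕ.≟ b
... | yes eq  = trans (δ-≡ eq) (sym (δ-≡ (to eq)))
... | no  neq = trans (δ-≢ neq) (sym (δ-≢ (neq ∘ from)))

δ-class : ∀ r q i → δ (r ℕ.+ q ℕ.* 3) (r ℕ.+ i ℕ.* 3) ≡ δ q i
δ-class zero    zero    zero    = refl
δ-class zero    zero    (suc i) = refl
δ-class zero    (suc q) zero    = refl
δ-class zero    (suc q) (suc i) = δ-class zero q i
δ-class (suc r) q       i       = δ-class r q i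

δ-class-≢ : ∀ r s → r ≢ s → ∀ q i → δ (toℕ r ℕ.+ q ℕ.* 3) (toℕ s ℕ.+ i ℕ.* 3) ≡ 0ℚ
δ-class-≢ r s r≢s q i =
  δ-≢ {toℕ r ℕ.+ q ℕ.* 3} {toℕ s ℕ.+ i ℕ.* 3} λ eq → r≢s
      (trans (sym (res-class r q)) (trans (cong res eq) (res-class s i)))

sum-δ : ∀ {K q} (f : ℕ → ℚ) → q < K → sum {K} (λ i → f (toℕ i) * δ q (toℕ i)) ≡ f q
sum-δ {suc K} {zero} f _ = trans
  (cong (f 0 * 1ℚ ℚ.+_) (sum-zero K λ i → *-zeroʳ (f (suc (toℕ i)))))
  (solve 1 (λ x → x :* con 1ℚ :+ con 0ℚ := x) refl (f 0))
sum-δ {suc K} {suc q} f (s≤s q<K) = trans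
  (cong₂ _+_ (*-zeroʳ (f 0)) (sum-δ (f ∘ suc) q<K)) (+-identityˡ (f (suc q)))

sum-δ-≥ : ∀ {K q} (f : ℕ → ℚ) → K ≤ q → sum {K} (λ i → f (toℕ i) * δ q (toℕ i)) ≡ 0ℚ
sum-δ-≥ {K} f K≤q = sum-zero K λ i → trans
  (cong (f (toℕ i) ℚ.*_) (δ-≢ (ℕ.>⇒≢ (ℕ.≤-trans (toℕ<n i) K≤q)))) (*-zeroʳ (f (toℕ i)))

module _ (a b g : ℕ → ℚ) where

  -- The summand of index `k = i + 1` in `z₁` or `z₂` at distance `ℓ`: the subscripts `3k - 2`,
  -- `3k - 1`, `3k` become `1 + 3i`, `2 + 3i`, `3 + 3i`, one in each residue class.
  terms : ℕ → ℕ → ℚ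
  terms ℓ i = a i * δ ℓ (1 ℕ.+ i ℕ.* 3) + b i * δ ℓ (2 ℕ.+ i ℕ.* 3) + g i * δ ℓ (3 ℕ.+ i ℕ.* 3)

  private
    pick : ∀ {x y z x′ y′ z′} i → x ≡ x′ → y ≡ y′ → z ≡ z′ →
           a i * x + b i * y + g i * z ≡ a i * x′ + b i * y′ + g i * z′
    pick i refl refl refl = refl

  terms-0 : ∀ i → terms 0 i ≡ 0ℚ
  terms-0 i = solve 3 (λ a b g → a :* con 0ℚ :+ b :* con 0ℚ :+ g :* con 0ℚ := con 0ℚ) refl (a i) (b i) (g i)

  terms-3 : ∀ q i → terms (suc q ℕ.* 3) i ≡ g i * δ q i
  terms-3 q i = trans
    (pick i (δ-class-≢ 0F 1F (λ ()) (suc q) i) (δ-class-≢ 0F 2F (λ ()) (suc q) i) (δ-class 0 q i))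
    (solve 4 (λ a b g d → a :* con 0ℚ :+ b :* con 0ℚ :+ g :* d := g :* d) refl (a i) (b i) (g i) (δ q i))

  terms-1 : ∀ q i → terms (1 ℕ.+ q ℕ.* 3) i ≡ a i * δ q i
  terms-1 q i = trans
    (pick i (δ-class 1 q i) (δ-class-≢ 1F 2F (λ ()) q i) (δ-class-≢ 1F 0F (λ ()) q (suc i)))
    (solve 4 (λ a b g d → a :* d :+ b :* con 0ℚ :+ g :* con 0ℚ := a :* d) refl (a i) (b i) (g i) (δ q i))

  terms-2 : ∀ q i → terms (2 ℕ.+ q ℕ.* 3) i ≡ b i * δ q i
  terms-2 q i = trans
    (pick i (δ-class-≢ 2F 1F (λ ()) q i) (δ-class 2 q i) (δ-class-≢ 2F 0F (λ ()) q (suc i)))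
    (solve 4 (λ a b g d → a :* con 0ℚ :+ b :* d :+ g :* con 0ℚ := b :* d) refl (a i) (b i) (g i) (δ q i))

  sum-terms : ℕ → ℕ → ℚ
  sum-terms K ℓ = sum {K} (λ i → terms ℓ (toℕ i))

  sum-terms-0 : ∀ K → sum-terms K 0 ≡ 0ℚ
  sum-terms-0 K = sum-zero K (terms-0 ∘ toℕ)

  sum-terms-3 : ∀ {K q} → q < K → sum-terms K (suc q ℕ.* 3) ≡ g q
  sum-terms-3 {K} {q} q<K = trans (sum-cong-≗ {K} (terms-3 q ∘ toℕ)) (sum-δ g q<K)

  sum-terms-1 : ∀ {K q} → q < K → sum-terms K (1 ℕ.+ q ℕ.* 3) ≡ a q
  sum-terms-1 {K} {q} q<K = trans (sum-cong-≗ {K} (terms-1 q ∘ toℕ)) (sum-δ a q<K)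

  sum-terms-1-≥ : ∀ {K q} → K ≤ q → sum-terms K (1 ℕ.+ q ℕ.* 3) ≡ 0ℚ
  sum-terms-1-≥ {K} {q} K≤q = trans (sum-cong-≗ {K} (terms-1 q ∘ toℕ)) (sum-δ-≥ a K≤q)

  sum-terms-2 : ∀ {K q} → q < K → sum-terms K (2 ℕ.+ q ℕ.* 3) ≡ b q
  sum-terms-2 {K} {q} q<K = trans (sum-cong-≗ {K} (terms-2 q ∘ toℕ)) (sum-δ b q<K)

-- ℓ is the distance of position j from position 0 on the cycle, so that c k is
-- the indicator of the positions with ℓ = k.
Folded : ∀ {m} → Fin m → ℕ → Set
Folded {m} j ℓ = (toℕ j ≡ ℓ ⊎ toℕ j ℕ.+ ℓ ≡ m) × ℓ ℕ.+ ℓ ≤ m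

folded : ∀ {m} (j : Fin m) → ∃[ ℓ ] Folded j ℓ
folded {m} j with toℕ j ℕ.+ toℕ j ℕ.≤? m
... | yes 2j≤m = toℕ j , inj₁ refl , 2j≤m
... | no  2j≰m = m ∸ toℕ j , inj₂ (ℕ.m+[n∸m]≡n j≤m) , (begin
  (m ∸ d) ℕ.+ (m ∸ d)  ≤⟨ ℕ.+-monoʳ-≤ (m ∸ d) (ℕ.m≤n+o⇒m∸n≤o m d (ℕ.<⇒≤ (ℕ.≰⇒> 2j≰m))) ⟩
  (m ∸ d) ℕ.+ d        ≡⟨ ℕ.m∸n+n≡m j≤m ⟩
  m                    ∎)
  where
  open ℕ.≤-Reasoning
  d = toℕ j
  j≤m = ℕ.<⇒≤ (toℕ<n j)

-- `c k` is supported on the positions `k` and `m - k`. Strictness of `2k < m` keeps these apart: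
-- `k + ℓ = m` would give `2m = 2k + 2ℓ < 2m`, so only one of the two summands can be nonzero.
c-folded : ∀ {m} {j : Fin m} {ℓ} → Folded j ℓ → ∀ k → k ℕ.+ k < m → c m k j ≡ δ ℓ k
c-folded {m} {j} {ℓ} (pos , 2ℓ≤m) k 2k<m = begin
  δ (suc d) (k ℕ.+ 1) + δ (suc d) (suc m ∸ k)
    ≡⟨ cong₂ (λ x y → δ (suc d) x + δ (suc d) y) (ℕ.+-comm k 1) (ℕ.+-∸-assoc 1 k≤m) ⟩
  δ d k + δ d (m ∸ k)
    ≡⟨ split pos ⟩
  δ ℓ k ∎
  where
  open ≡-Reasoning
  d = toℕ j

  k≤m : k ≤ m
  k≤m = ℕ.≤-trans (ℕ.m≤m+n k k) (ℕ.<⇒≤ 2k<m)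

  k+ℓ≢m : k ℕ.+ ℓ ≢ m
  k+ℓ≢m eq = ℕ.<-irrefl (cong₂ ℕ._+_ eq eq) (subst (ℕ._< m ℕ.+ m) swap (ℕ.+-mono-<-≤ 2k<m 2ℓ≤m))
    where
    swap : (k ℕ.+ k) ℕ.+ (ℓ ℕ.+ ℓ) ≡ (k ℕ.+ ℓ) ℕ.+ (k ℕ.+ ℓ)
    swap = trans (ℕ.+-assoc k k (ℓ ℕ.+ ℓ)) (trans (cong (k ℕ.+_) (trans (sym (ℕ.+-assoc k ℓ ℓ))
      (trans (cong (ℕ._+ ℓ) (ℕ.+-comm k ℓ)) (ℕ.+-assoc ℓ k ℓ)))) (sym (ℕ.+-assoc k ℓ (k ℕ.+ ℓ))))

  split : d ≡ ℓ ⊎ d ℕ.+ ℓ ≡ m → δ d k + δ d (m ∸ k) ≡ δ ℓ k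
  split (inj₁ refl) = trans
    (cong (δ d k ℚ.+_) (δ-≢ {d} {m ∸ k} λ d≡m∸k → k+ℓ≢m (trans (cong (k ℕ.+_) d≡m∸k) (ℕ.m+[n∸m]≡n k≤m))))
    (+-identityʳ (δ d k))
  split (inj₂ d+ℓ≡m) = trans
    (cong₂ _+_ (δ-≢ {d} {k} λ { refl → k+ℓ≢m d+ℓ≡m })
      (δ-cong-⇔ {d} {m ∸ k} {ℓ} {k}
        (λ { d≡m∸k → ℕ.+-cancelˡ-≡ d ℓ k (trans d+ℓ≡m (sym (trans (cong (ℕ._+ k) d≡m∸k) (ℕ.m∸n+n≡m k≤m)))) })
        (λ { refl → trans (sym (ℕ.m+n∸n≡m d ℓ)) (cong (_∸ ℓ) d+ℓ≡m) })))
    (+-identityˡ (δ ℓ k))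

-- The off-diagonal entries of the first row of `3(n - 1)P` by distance, the same for both parities.
-- The term `δ q 0` makes the value 0 at distance 0, whose coefficient is added separately.
foldedRow : ℕ → ℕ → ℚ
foldedRow m = tri (λ q → 1ℚ - δ q 0) (λ q → α m (suc q)) (λ q → - β m (suc q))

foldedRow-0 : ∀ m q → foldedRow m (suc q ℕ.* 3) ≡ 1ℚ
foldedRow-0 m q = tri-0 (λ q → 1ℚ - δ q 0) (λ q → α m (suc q)) (λ q → - β m (suc q)) (suc q)

foldedRow-1 : ∀ m q → foldedRow m (1 ℕ.+ q ℕ.* 3) ≡ α m (suc q)
foldedRow-1 m = tri-1 (λ q → 1ℚ - δ q 0) (λ q → α m (suc q)) (λ q → - β m (suc q))

foldedRow-2 : ∀ m q → foldedRow m (2 ℕ.+ q ℕ.* 3) ≡ - β m (suc q)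
foldedRow-2 m = tri-2 (λ q → 1ℚ - δ q 0) (λ q → α m (suc q)) (λ q → - β m (suc q))

+-double-suc : ∀ a → suc a ℕ.+ suc a ≡ 2 ℕ.+ (a ℕ.+ a)
+-double-suc a = cong suc (ℕ.+-suc a a)

*3-cancel-< : ∀ q t → q ℕ.* 3 < t ℕ.* 3 → q < t
*3-cancel-< q t = ℕ.*-cancelʳ-< 3 q t

double-< : ∀ {a b m} → a < b → b ℕ.+ b ≤ m → a ℕ.+ a < m
double-< a<b 2b≤m = ℕ.<-≤-trans (ℕ.+-mono-< a<b a<b) 2b≤m

≤-of-double : ∀ {a b m} → a ℕ.+ a ≤ m → m < suc b ℕ.+ suc b → a ≤ b
≤-of-double {a} {b} 2a≤m m<2b = ℕ.≮⇒≥ λ b<a →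
  ℕ.<-irrefl refl (ℕ.<-≤-trans m<2b (ℕ.≤-trans (ℕ.+-mono-≤ b<a b<a) 2a≤m))

t*3-double : ∀ t → t ℕ.* 3 ℕ.+ t ℕ.* 3 ≡ t ℕ.* 2 ℕ.* 3
t*3-double t = trans (sym (ℕ.*-distribʳ-+ 3 t t))
    (cong (ℕ._* 3) (sym (trans (ℕ.*-comm t 2) (cong (t ℕ.+_) (ℕ.+-identityʳ t)))))

t*6-half : ∀ t → t ℕ.* 2 ℕ.* 3 ≡ t ℕ.* 3 ℕ.* 2
t*6-half t = trans (ℕ.*-assoc t 2 3) (sym (ℕ.*-assoc t 3 2))

-- Here `n = 6t + 4`: the sum has `t` complete triples, and the half cycle ends at distance
-- `1 + 3t = n/2 - 1`.
module Even (t : ℕ) where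
  m : ℕ
  m = 3 ℕ.+ t ℕ.* 2 ℕ.* 3

  private
    Fa Fb Fg : ℕ → ℚ
    Fa i = α m (suc i)
    Fb i = - β m (suc i)
    Fg _ = 1ℚ

  -- The isolated last term of `z₁` has coefficient 1 and sits at distance `1 + 3t`, where the
  -- pattern asks for `α m (suc t)`; the two agree, so that term merely continues the pattern.
  αₜ≡1 : α m (suc t) ≡ 1ℚ
  αₜ≡1 = begin
    (↑ 3 * ↑ (4 ℕ.+ t ℕ.* 2 ℕ.* 3) - ↑ 18 * ↑ (1 ℕ.+ t) + ↑ 8) * ½
      ≡⟨ cong₂ (λ x y → (↑ 3 * x - ↑ 18 * y + ↑ 8) * ½)
           (trans (↑-+ 4 (t ℕ.* 2 ℕ.* 3)) (cong (↑ 4 ℚ.+_) (trans (↑-* (t ℕ.* 2) 3) (cong (_* ↑ 3) (↑-* t 2)))))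
           (↑-+ 1 t) ⟩
    (↑ 3 * (↑ 4 + ↑ t * ↑ 2 * ↑ 3) - ↑ 18 * (1ℚ + ↑ t) + ↑ 8) * ½
      ≡⟨ solve 1 (λ t → (con (↑ 3) :* (con (↑ 4) :+ t :* con (↑ 2) :* con (↑ 3))
          :- con (↑ 18) :* (con 1ℚ :+ t) :+ con (↑ 8)) :* con ½ := con 1ℚ) refl (↑ t) ⟩
    1ℚ ∎
    where open ≡-Reasoning

  total₁ : ∀ q → q < t ⊎ q ≡ t →
           sum-terms Fa Fb Fg t (1 ℕ.+ q ℕ.* 3) + δ (1 ℕ.+ q ℕ.* 3) (1 ℕ.+ t ℕ.* 3) ≡ foldedRow m
               (1 ℕ.+ q ℕ.* 3)
  total₁ q (inj₁ q<t) = trans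
    (cong₂ _+_ (sum-terms-1 Fa Fb Fg q<t) (trans (δ-class 1 q t) (δ-≢ (ℕ.<⇒≢ q<t))))
    (trans (+-identityʳ _) (sym (foldedRow-1 m q)))
  total₁ _ (inj₂ refl) = trans
    (cong₂ _+_ (sum-terms-1-≥ Fa Fb Fg {t} ℕ.≤-refl) (trans (δ-class 1 t t) (δ-≡ {t} refl)))
    (trans (sym αₜ≡1) (sym (foldedRow-1 m t)))

  total : ∀ ℓ → Mod3 ℓ → ℓ ≤ 1 ℕ.+ t ℕ.* 3 → sum-terms Fa Fb Fg t ℓ + δ ℓ (1 ℕ.+ t ℕ.* 3) ≡ foldedRow m ℓ
  total _ (0+ zero)    ℓ≤ = cong (_+ 0ℚ) (sum-terms-0 Fa Fb Fg t)
  total _ (0+ (suc q)) ℓ≤ = trans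
    (cong₂ _+_ (sum-terms-3 Fa Fb Fg {t} (*3-cancel-< q t (ℕ.≤-trans (ℕ.n≤1+n _) (ℕ.s≤s⁻¹ ℓ≤))))
               (δ-class-≢ 0F 1F (λ ()) (suc q) t))
    (sym (foldedRow-0 m q))
  total _ (1+ q)       ℓ≤ = total₁ q (ℕ.m≤n⇒m<n∨m≡n (ℕ.*-cancelʳ-≤ q t 3 (ℕ.s≤s⁻¹ ℓ≤)))
  total _ (2+ q)       ℓ≤ = trans
    (cong₂ _+_ (sum-terms-2 Fa Fb Fg {t} (*3-cancel-< q t (ℕ.s≤s⁻¹ ℓ≤))) (δ-class-≢ 2F 1F (λ ()) q t))
    (trans (+-identityʳ _) (sym (foldedRow-2 m q)))

  z₁≡ : ∀ {ℓ} (j : Fin m) → Folded j ℓ →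
        z₁ m j ≡ (↑ 2 * ↑ suc m - ↑ suc m * ↑ suc m) * δ (toℕ j) 0 + foldedRow m ℓ
  z₁≡ {ℓ} j fd@(_ , 2ℓ≤m) = trans
    (cong₂ (λ x y → head + x + y) sums middle)
    (trans (ℚ.+-assoc head _ _) (cong (head ℚ.+_) (total ℓ (mod3 ℓ) (≤-of-double 2ℓ≤m (ℕ.≤-reflexive bound)))))
    where
    head = (↑ 2 * ↑ suc m - ↑ suc m * ↑ suc m) * δ (toℕ j) 0

    bound : 4 ℕ.+ t ℕ.* 2 ℕ.* 3 ≡ (2 ℕ.+ t ℕ.* 3) ℕ.+ (2 ℕ.+ t ℕ.* 3)
    bound = trans (cong (4 ℕ.+_) (sym (t*3-double t)))
        (sym (trans (+-double-suc (1 ℕ.+ t ℕ.* 3)) (cong (2 ℕ.+_) (+-double-suc (t ℕ.* 3)))))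

    c-δ : ∀ k → k ≤ 1 ℕ.+ t ℕ.* 3 → c m k j ≡ δ ℓ k
    c-δ k k≤ = c-folded fd k (s≤s (begin
      k ℕ.+ k                                    ≤⟨ ℕ.+-mono-≤ k≤ k≤ ⟩
      suc (t ℕ.* 3) ℕ.+ suc (t ℕ.* 3)            ≡⟨ +-double-suc (t ℕ.* 3) ⟩
      2 ℕ.+ (t ℕ.* 3 ℕ.+ t ℕ.* 3)                ≡⟨ cong (2 ℕ.+_) (t*3-double t) ⟩
      2 ℕ.+ t ℕ.* 2 ℕ.* 3                        ∎))
      where open ℕ.≤-Reasoning

    middle : c m (suc m ℕ./ 2 ∸ 1) j ≡ δ ℓ (1 ℕ.+ t ℕ.* 3)
    middle = trans
      (cong (λ k → c m (k ∸ 1) j) (trans (cong (λ k → (4 ℕ.+ k) ℕ./ 2) (t*6-half t))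
          (m*n/n≡m (2 ℕ.+ t ℕ.* 3) 2)))
      (c-δ (1 ℕ.+ t ℕ.* 3) ℕ.≤-refl)

    term : ∀ i → i < t →
      α m (suc i) * c m (3 ℕ.* suc i ∸ 2) j - β m (suc i) * c m (3 ℕ.* suc i ∸ 1) j + c m (3 ℕ.* suc i) j
        ≡ terms Fa Fb Fg ℓ i
    term i i<t = begin
      α m (suc i) * c m (3 ℕ.* suc i ∸ 2) j - β m (suc i) * c m (3 ℕ.* suc i ∸ 1) j + c m (3 ℕ.* suc i) j
        ≡⟨ cong (λ k → α m (suc i) * c m (k ∸ 2) j - β m (suc i) * c m (k ∸ 1) j + c m k j)
            (ℕ.*-comm 3 (suc i)) ⟩
      α m (suc i) * c m (1 ℕ.+ i ℕ.* 3) j - β m (suc i) * c m (2 ℕ.+ i ℕ.* 3) j + c m (3 ℕ.+ i ℕ.* 3) j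
        ≡⟨ cong₂ _+_ (cong₂ (λ x y → α m (suc i) * x - β m (suc i) * y)
            (c-δ _ (ℕ.≤-trans (ℕ.m≤n+m _ 2) k≤)) (c-δ _ (ℕ.≤-trans (ℕ.n≤1+n _) k≤))) (c-δ _ k≤) ⟩
      α m (suc i) * δ ℓ (1 ℕ.+ i ℕ.* 3) - β m (suc i) * δ ℓ (2 ℕ.+ i ℕ.* 3) + δ ℓ (3 ℕ.+ i ℕ.* 3)
        ≡⟨ solve 5 (λ a b x y z → a :* x :- b :* y :+ z := a :* x :+ (:- b) :* y :+ con 1ℚ :* z) refl
            (α m (suc i)) (β m (suc i)) (δ ℓ (1 ℕ.+ i ℕ.* 3)) (δ ℓ (2 ℕ.+ i ℕ.* 3)) (δ ℓ (3 ℕ.+ i ℕ.* 3)) ⟩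
      terms Fa Fb Fg ℓ i ∎
      where
      open ≡-Reasoning
      k≤ : 3 ℕ.+ i ℕ.* 3 ≤ 1 ℕ.+ t ℕ.* 3
      k≤ = ℕ.≤-trans (ℕ.*-monoˡ-≤ 3 i<t) (ℕ.n≤1+n _)

    F : ℕ → ℚ
    F k = α m k * c m (3 ℕ.* k ∸ 2) j - β m k * c m (3 ℕ.* k ∸ 1) j + c m (3 ℕ.* k) j

    sums : (∑[ (suc m ∸ 4) ℕ./ 6 ] F) ≡ sum-terms Fa Fb Fg t ℓ
    sums = trans (cong (λ K → ∑[ K ] F) (trans (cong (ℕ._/ 6) (ℕ.*-assoc t 2 3)) (m*n/n≡m t 6)))
                 (sum-cong-≗ {t} λ i → term (toℕ i) (toℕ<n i))

-- The antipode of position 0 is its own mirror image, so a single `e` marks it where a `c` would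
-- count it twice.
e-folded : ∀ {m} {j : Fin m} {ℓ} → Folded j ℓ → ∀ h → h ℕ.+ h ≡ m → δ (toℕ j) h ≡ δ ℓ h
e-folded (inj₁ refl , _) h 2h≡m = refl
e-folded {m} {j} {ℓ} (inj₂ d+ℓ≡m , _) h 2h≡m = δ-cong-⇔ {toℕ j} {h} {ℓ} {h}
  (λ d≡h → ℕ.+-cancelˡ-≡ h ℓ h (trans (cong (ℕ._+ ℓ) (sym d≡h)) (trans d+ℓ≡m (sym 2h≡m))))
  (λ ℓ≡h → ℕ.+-cancelʳ-≡ h (toℕ j) h (trans (cong (toℕ j ℕ.+_) (sym ℓ≡h)) (trans d+ℓ≡m (sym 2h≡m))))

-- Here `n = 6t + 1` with `t = s + 1`, so that `s = (n - 7)/6`, and the half cycle ends at the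
-- antipode `3t`.
module Odd (s : ℕ) where
  t m : ℕ
  t = suc s
  m = t ℕ.* 2 ℕ.* 3

  private
    Fa Fb Fg : ℕ → ℚ
    Fa i = α m (suc i)
    Fb i = - β m (suc i)
    Fg _ = 0ℚ

    sum₂ : ℕ → ℚ
    sum₂ ℓ = sum {s} (λ i → δ ℓ (3 ℕ.+ toℕ i ℕ.* 3))

    sum₂-0 : ∀ q → sum₂ (suc q ℕ.* 3) ≡ sum {s} (λ i → 1ℚ * δ q (toℕ i))
    sum₂-0 q = sum-cong-≗ {s} λ i → trans (δ-class 0 q (toℕ i)) (sym (*-identityˡ (δ q (toℕ i))))

  -- On the multiples of 3 the value 1 comes from the second sum up to distance `3s`, and from the
  -- antipodal `e` at distance `3t`.
  total₀ : ∀ q → q < s ⊎ q ≡ s →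
           sum-terms Fa Fb Fg t (suc q ℕ.* 3) + sum₂ (suc q ℕ.* 3) + δ (suc q ℕ.* 3) (t ℕ.* 3) ≡ foldedRow
               m (suc q ℕ.* 3)
  total₀ q (inj₁ q<s) = trans
    (cong₂ _+_ (cong₂ _+_ (sum-terms-3 Fa Fb Fg {t} (ℕ.m<n⇒m<1+n q<s))
        (trans (sum₂-0 q) (sum-δ (λ _ → 1ℚ) q<s)))
               (trans (δ-class 0 q s) (δ-≢ (ℕ.<⇒≢ q<s))))
    (sym (foldedRow-0 m q))
  total₀ _ (inj₂ refl) = trans
    (cong₂ _+_ (cong₂ _+_ (sum-terms-3 Fa Fb Fg {t} (ℕ.n<1+n s))
                          (trans (sum₂-0 s) (sum-δ-≥ {s} {s} (λ _ → 1ℚ) ℕ.≤-refl)))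
               (trans (δ-class 0 s s) (δ-≡ {s} refl)))
    (sym (foldedRow-0 m s))

  total : ∀ ℓ → Mod3 ℓ → ℓ ≤ t ℕ.* 3 → sum-terms Fa Fb Fg t ℓ + sum₂ ℓ + δ ℓ (t ℕ.* 3) ≡ foldedRow m ℓ
  total _ (0+ zero)    ℓ≤ = cong₂ (λ x y → x + y + 0ℚ) (sum-terms-0 Fa Fb Fg t) (sum-zero s λ i → refl)
  total _ (0+ (suc q)) ℓ≤ =
    total₀ q (ℕ.m≤n⇒m<n∨m≡n (ℕ.*-cancelʳ-≤ q s 3 (ℕ.+-cancelˡ-≤ 3 (q ℕ.* 3) (s ℕ.* 3) ℓ≤)))
  total _ (1+ q)       ℓ≤ = trans
    (cong₂ _+_ (cong₂ _+_ (sum-terms-1 Fa Fb Fg (*3-cancel-< q t ℓ≤))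
                          (sum-zero s λ i → δ-class-≢ 1F 0F (λ ()) q (suc (toℕ i))))
               (δ-class-≢ 1F 0F (λ ()) q t))
    (trans (solve 1 (λ x → x :+ con 0ℚ :+ con 0ℚ := x) refl (α m (suc q))) (sym (foldedRow-1 m q)))
  total _ (2+ q)       ℓ≤ = trans
    (cong₂ _+_ (cong₂ _+_ (sum-terms-2 Fa Fb Fg (*3-cancel-< q t (ℕ.≤-trans (ℕ.n≤1+n _) ℓ≤)))
                          (sum-zero s λ i → δ-class-≢ 2F 0F (λ ()) q (suc (toℕ i))))
               (δ-class-≢ 2F 0F (λ ()) q t))
    (trans (solve 1 (λ x → x :+ con 0ℚ :+ con 0ℚ := x) refl (- β m (suc q))) (sym (foldedRow-2 m q)))

  z₂≡ : ∀ {ℓ} (j : Fin m) → Folded j ℓ →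
        z₂ m j ≡ (↑ 2 * ↑ suc m - ↑ suc m * ↑ suc m) * δ (toℕ j) 0 + foldedRow m ℓ
  z₂≡ {ℓ} j fd@(_ , 2ℓ≤m) = trans
    (cong₂ _+_ (cong₂ (λ x y → head + x + y) sums₁ sums₂) middle)
    (trans (solve 4 (λ a b c d → a :+ b :+ c :+ d := a :+ (b :+ c :+ d)) refl head
        (sum-terms Fa Fb Fg t ℓ) (sum₂ ℓ) (δ ℓ (t ℕ.* 3)))
           (cong (head ℚ.+_) (total ℓ (mod3 ℓ) (≤-of-double 2ℓ≤m
               (ℕ.<-≤-trans (s≤s (ℕ.≤-trans (ℕ.≤-reflexive (sym (t*3-double t))) (ℕ.n≤1+n _)))
               (ℕ.≤-reflexive (sym (+-double-suc (t ℕ.* 3)))))))))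
    where
    head = (↑ 2 * ↑ suc m - ↑ suc m * ↑ suc m) * δ (toℕ j) 0

    c-δ : ∀ k → k < t ℕ.* 3 → c m k j ≡ δ ℓ k
    c-δ k k< = c-folded fd k (double-< k< (ℕ.≤-reflexive (t*3-double t)))

    middle : e m ((suc m ℕ.+ 1) ℕ./ 2) j ≡ δ ℓ (t ℕ.* 3)
    middle = trans
      (cong (δ (suc (toℕ j))) (trans (cong (ℕ._/ 2)
          (trans (ℕ.+-comm (suc m) 1) (cong (2 ℕ.+_) (t*6-half t)))) (m*n/n≡m (1 ℕ.+ t ℕ.* 3) 2)))
      (e-folded fd (t ℕ.* 3) (t*3-double t))

    term : ∀ i → i < t →
      α m (suc i) * c m (3 ℕ.* suc i ∸ 2) j - β m (suc i) * c m (3 ℕ.* suc i ∸ 1) j ≡ terms Fa Fb Fg ℓ i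
    term i i<t = begin
      α m (suc i) * c m (3 ℕ.* suc i ∸ 2) j - β m (suc i) * c m (3 ℕ.* suc i ∸ 1) j
        ≡⟨ cong (λ k → α m (suc i) * c m (k ∸ 2) j - β m (suc i) * c m (k ∸ 1) j) (ℕ.*-comm 3 (suc i)) ⟩
      α m (suc i) * c m (1 ℕ.+ i ℕ.* 3) j - β m (suc i) * c m (2 ℕ.+ i ℕ.* 3) j
        ≡⟨ cong₂ (λ x y → α m (suc i) * x - β m (suc i) * y)
            (c-δ (1 ℕ.+ i ℕ.* 3) (ℕ.<-trans (ℕ.n<1+n _) k<)) (c-δ (2 ℕ.+ i ℕ.* 3) k<) ⟩
      α m (suc i) * δ ℓ (1 ℕ.+ i ℕ.* 3) - β m (suc i) * δ ℓ (2 ℕ.+ i ℕ.* 3)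
        ≡⟨ solve 5 (λ a b x y z → a :* x :- b :* y := a :* x :+ (:- b) :* y :+ con 0ℚ :* z) refl
            (α m (suc i)) (β m (suc i)) (δ ℓ (1 ℕ.+ i ℕ.* 3)) (δ ℓ (2 ℕ.+ i ℕ.* 3)) (δ ℓ (3 ℕ.+ i ℕ.* 3)) ⟩
      terms Fa Fb Fg ℓ i ∎
      where
      open ≡-Reasoning
      k< : 2 ℕ.+ i ℕ.* 3 < t ℕ.* 3
      k< = ℕ.*-monoˡ-≤ 3 i<t

    F₁ F₂ : ℕ → ℚ
    F₁ k = α m k * c m (3 ℕ.* k ∸ 2) j - β m k * c m (3 ℕ.* k ∸ 1) j
    F₂ k = c m (3 ℕ.* k) j

    sums₁ : (∑[ (suc m ∸ 1) ℕ./ 6 ] F₁) ≡ sum-terms Fa Fb Fg t ℓ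
    sums₁ = trans (cong (λ K → ∑[ K ] F₁) (trans (cong (ℕ._/ 6) (ℕ.*-assoc t 2 3)) (m*n/n≡m t 6)))
                  (sum-cong-≗ {t} λ i → term (toℕ i) (toℕ<n i))

    sums₂ : (∑[ (suc m ∸ 7) ℕ./ 6 ] F₂) ≡ sum₂ ℓ
    sums₂ = trans (cong (λ K → ∑[ K ] F₂) (trans (cong (ℕ._/ 6) (ℕ.*-assoc s 2 3)) (m*n/n≡m s 6)))
                  (sum-cong-≗ {s} λ i → trans (cong (λ k → c m k j) (ℕ.*-comm 3 (suc (toℕ i))))
                    (c-δ (3 ℕ.+ toℕ i ℕ.* 3) (s≤s (ℕ.≤-trans (ℕ.*-monoˡ-≤ 3 (toℕ<n i)) (ℕ.m≤n+m (s ℕ.* 3) 2)))))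

-- The matrices T, Y and Z

module _ {p : ℕ} {a} {A : Set a} (f : ℕ → A) (periodic : f (suc p) ≡ f 0) where

  -- The condition `f m = f 0` makes `next` act as a plain successor even at the last position. Only
  -- `prev` at position zero still wraps, hence the separate formulas `N-zero` and `N-suc`.
  periodic-next : (j : Fin (suc p)) → f (toℕ (next j)) ≡ f (suc (toℕ j))
  periodic-next j with view j
  ... | ‵fromℕ     = trans (sym periodic) (cong (f ∘ suc) (sym (toℕ-fromℕ p)))
  ... | ‵inject₁ i = cong (f ∘ suc) (sym (toℕ-inject₁ i))

module _ {p : ℕ} (f : ℕ → ℚ) (periodic : f (suc p) ≡ f 0) where

  N-zero : N {p} (f ∘ toℕ) zero ≡ f 0 + f 1 + f p
  N-zero = cong₂ (λ x y → f 0 + x + y) (periodic-next f periodic zero) (cong f (toℕ-fromℕ p))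

  N-suc : (j : Fin p) → N {p} (f ∘ toℕ) (suc j) ≡ f (toℕ j) + f (1 ℕ.+ toℕ j) + f (2 ℕ.+ toℕ j)
  N-suc j = trans
    (cong₂ (λ x y → f (suc (toℕ j)) + x + y) (periodic-next f periodic (suc j)) (cong f (toℕ-inject₁ j)))
    (solve 3 (λ x y z → y :+ z :+ x := x :+ y :+ z) refl (f (toℕ j)) (f (1 ℕ.+ toℕ j)) (f (2 ℕ.+ toℕ j)))

N-row-circulant : ∀ {p} {A : Matrix ℚ (suc p) (suc p)} → Circulant A → Circulant (λ i j → N (A i) j)
N-row-circulant {A = A} circ i j = cong₂ _+_ (cong₂ _+_ (circ i j) (circ i (next j)))
  (trans (circulant-nextˡ circ i (prev (next j))) (cong (A i ∘ prev) (prev-next j)))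

-- On a cycle of length three, a vertex and its two neighbours are all the vertices, each occurring
-- once. This is what makes `N` constant on `T`.
N-identity₃ : ∀ (a b : Fin 3) → N (λ k → identity k b) a ≡ 1ℚ
N-identity₃ 0F 0F = refl
N-identity₃ 0F 1F = refl
N-identity₃ 0F 2F = refl
N-identity₃ 1F 0F = refl
N-identity₃ 1F 1F = refl
N-identity₃ 1F 2F = refl
N-identity₃ 2F 0F = refl
N-identity₃ 2F 1F = refl
N-identity₃ 2F 2F = refl

res-suc : ∀ k → res (suc k) ≡ next (res k)
res-suc k with mod3 k
... | 0+ q = trans (res-class 1F q) (cong next (sym (res-class 0F q)))
... | 1+ q = trans (res-class 2F q) (cong next (sym (res-class 1F q)))
... | 2+ q = trans (res-class 0F (suc q)) (cong next (sym (res-class 2F q)))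

module Inverse (K′ : ℕ) where
  K m : ℕ
  K = suc K′
  m = K ℕ.* 3

  ρ κ : ℚ
  ρ = + 1 ℚ./ m
  κ = ↑ K

  m*ρ≡1 : ↑ m * ρ ≡ 1ℚ
  m*ρ≡1 = ↑-inverse m

  3κρ≡1 : ↑ 3 * κ * ρ ≡ 1ℚ
  3κρ≡1 = trans (cong (_* ρ) (trans (ℚ.*-comm (↑ 3) κ) (sym (↑-* K 3)))) m*ρ≡1

  -- H q = h 0 + … + h (q - 1)
  h H y z : ℕ → ℚ
  h q = (↑ 2 * ↑ q + 1ℚ - κ) * ((+ 3 ℚ./ 4) * ρ)
  H q = (↑ q * ↑ q - κ * ↑ q) * ((+ 3 ℚ./ 4) * ρ)
  y = tri (λ _ → 0ℚ) h (λ q → - h q)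
  z = tri (λ q → - ↑ 2 * H q) H (H ∘ suc)

  y-0 : ∀ q → y (q ℕ.* 3) ≡ 0ℚ
  y-0 = tri-0 (λ _ → 0ℚ) h (λ q → - h q)
  y-1 : ∀ q → y (1 ℕ.+ q ℕ.* 3) ≡ h q
  y-1 = tri-1 (λ _ → 0ℚ) h (λ q → - h q)
  y-2 : ∀ q → y (2 ℕ.+ q ℕ.* 3) ≡ - h q
  y-2 = tri-2 (λ _ → 0ℚ) h (λ q → - h q)
  z-0 : ∀ q → z (q ℕ.* 3) ≡ - ↑ 2 * H q
  z-0 = tri-0 (λ q → - ↑ 2 * H q) H (H ∘ suc)
  z-1 : ∀ q → z (1 ℕ.+ q ℕ.* 3) ≡ H q
  z-1 = tri-1 (λ q → - ↑ 2 * H q) H (H ∘ suc)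
  z-2 : ∀ q → z (2 ℕ.+ q ℕ.* 3) ≡ H (suc q)
  z-2 = tri-2 (λ q → - ↑ 2 * H q) H (H ∘ suc)

  H-0 : H 0 ≡ 0ℚ
  H-0 = solve 2 (λ k r → (con 0ℚ :* con 0ℚ :- k :* con 0ℚ) :* (con (+ 3 ℚ./ 4) :* r) := con 0ℚ) refl κ ρ

  H-K : H K ≡ 0ℚ
  H-K = solve 2 (λ k r → (k :* k :- k :* k) :* (con (+ 3 ℚ./ 4) :* r) := con 0ℚ) refl κ ρ

  H-suc : ∀ q → H (suc q) ≡ H q + h q
  H-suc q = trans (cong (λ x → (x * x - κ * x) * ((+ 3 ℚ./ 4) * ρ)) (↑-+ 1 q))
    (solve 3 (λ q k r → ((con 1ℚ :+ q) :* (con 1ℚ :+ q) :- k :* (con 1ℚ :+ q)) :* (con (+ 3 ℚ./ 4) :* r)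
      := (q :* q :- k :* q) :* (con (+ 3 ℚ./ 4) :* r)
          :+ (con (↑ 2) :* q :+ con 1ℚ :- k) :* (con (+ 3 ℚ./ 4) :* r)) refl (↑ q) κ ρ)

  h-suc : ∀ q → h (suc q) ≡ h q + (+ 3 ℚ./ 2) * ρ
  h-suc q = trans (cong (λ x → (↑ 2 * x + 1ℚ - κ) * ((+ 3 ℚ./ 4) * ρ)) (↑-+ 1 q))
    (solve 3 (λ q k r → (con (↑ 2) :* (con 1ℚ :+ q) :+ con 1ℚ :- k) :* (con (+ 3 ℚ./ 4) :* r)
      := (con (↑ 2) :* q :+ con 1ℚ :- k) :* (con (+ 3 ℚ./ 4) :* r) :+ con (+ 3 ℚ./ 2) :* r) refl (↑ q) κ ρ)

  -- `h` is linear and centred on the range from 0 to `K′`. This gives the value of `N` at the wrap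
  -- as well as the symmetry of the row `y`.
  h-reflect : ∀ q s → q ℕ.+ s ≡ K′ → - h s ≡ h q
  h-reflect q s q+s≡K′ = begin
    - h s
      ≡⟨ cong (λ k → - ((↑ 2 * ↑ s + 1ℚ - k) * ((+ 3 ℚ./ 4) * ρ))) κ≡ ⟩
    - ((↑ 2 * ↑ s + 1ℚ - (1ℚ + (↑ q + ↑ s))) * ((+ 3 ℚ./ 4) * ρ))
      ≡⟨ solve 3 (λ q s c → :- ((con (↑ 2) :* s :+ con 1ℚ :- (con 1ℚ :+ (q :+ s))) :* c)
           := (con (↑ 2) :* q :+ con 1ℚ :- (con 1ℚ :+ (q :+ s))) :* c) refl (↑ q) (↑ s) ((+ 3 ℚ./ 4) * ρ) ⟩
    (↑ 2 * ↑ q + 1ℚ - (1ℚ + (↑ q + ↑ s))) * ((+ 3 ℚ./ 4) * ρ)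
      ≡⟨ cong (λ k → (↑ 2 * ↑ q + 1ℚ - k) * ((+ 3 ℚ./ 4) * ρ)) κ≡ ⟨
    h q ∎
    where
    open ≡-Reasoning
    κ≡ : κ ≡ 1ℚ + (↑ q + ↑ s)
    κ≡ = trans (cong (↑_ ∘ suc) (sym q+s≡K′)) (trans (↑-+ 1 (q ℕ.+ s)) (cong (1ℚ ℚ.+_) (↑-+ q s)))

  y-periodic : y m ≡ y 0
  y-periodic = y-0 K

  -- By its antisymmetry `h` sums to zero over a full turn, so the partial sums `H` close up.
  z-periodic : z m ≡ z 0
  z-periodic = trans (z-0 K) (cong (- ↑ 2 ℚ.*_) (trans H-K (sym H-0)))

  T Y Z : Matrix ℚ m m
  T i j = ↑ 3 * ρ * identity (res (toℕ i)) (res (toℕ j))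
  Y = Circ (y ∘ toℕ)
  Z = Circ (z ∘ toℕ)

  res-next : (i : Fin m) → res (toℕ (next i)) ≡ next (res (toℕ i))
  res-next i = trans (periodic-next res (res-class 0F K) i) (res-suc (toℕ i))

  res-prev : (i : Fin m) → res (toℕ (prev i)) ≡ prev (res (toℕ i))
  res-prev i = trans (sym (prev-next (res (toℕ (prev i)))))
    (cong prev (trans (sym (res-next (prev i))) (cong (res ∘ toℕ) (next-prev i))))

  T-sym : ∀ i j → T i j ≡ T j i
  T-sym i j = cong (↑ 3 * ρ ℚ.*_) (identity-sym (res (toℕ i)) (res (toℕ j)))

  T-circulant : Circulant T
  T-circulant i j = cong (↑ 3 * ρ ℚ.*_)
    (trans (cong₂ identity (res-next i) (res-next j)) (identity-circulant (res (toℕ i)) (res (toℕ j))))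

  N-T : ∀ i j → N (λ k → T k j) i ≡ ↑ 3 * ρ
  N-T i j = begin
    N (λ k → T k j) i
      ≡⟨ cong₂ (λ a b → τ * identity (res (toℕ i)) r + τ * identity a r + τ * identity b r) (res-next i)
          (res-prev i) ⟩
    τ * identity a r + τ * identity (next a) r + τ * identity (prev a) r
      ≡⟨ solve 4 (λ t x y z → t :* x :+ t :* y :+ t :* z := t :* (x :+ y :+ z)) refl τ (identity a r)
          (identity (next a) r) (identity (prev a) r) ⟩
    τ * N (λ k → identity k r) a
      ≡⟨ cong (τ ℚ.*_) (N-identity₃ a r) ⟩
    τ * 1ℚ
      ≡⟨ ℚ.*-identityʳ τ ⟩
    τ ∎
    where
    open ≡-Reasoning
    τ = ↑ 3 * ρ
    a r : Fin 3
    a = res (toℕ i)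
    r = res (toℕ j)

  Y-circulant : Circulant Y
  Y-circulant = Circ-circulant (y ∘ toℕ)

  Z-circulant : Circulant Z
  Z-circulant = Circ-circulant (z ∘ toℕ)

  +₃-cong : ∀ {a b c x y z : ℚ} → a ≡ x → b ≡ y → c ≡ z → a + b + c ≡ x + y + z
  +₃-cong refl refl refl = refl

  -- A window of three centred in class 1 or 2 contains `h q`, `- h q` and a zero. Centred at a
  -- positive multiple of 3 it shows the increment of `h`; at 0 it shows `2 h 0` across the wrap,
  -- and `3κρ = 1` supplies the `- ½` coming from the identity matrix.
  N-y : ∀ (j : Fin m) → N (y ∘ toℕ) j ≡ ½ * (T zero j - identity zero j)
  N-y zero = begin
    N {2 ℕ.+ K′ ℕ.* 3} (y ∘ toℕ) zero
      ≡⟨ N-zero {2 ℕ.+ K′ ℕ.* 3} y y-periodic ⟩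
    0ℚ + h 0 + y (2 ℕ.+ K′ ℕ.* 3)
      ≡⟨ cong (0ℚ + h 0 ℚ.+_) (trans (y-2 K′) (h-reflect 0 K′ refl)) ⟩
    0ℚ + h 0 + h 0
      ≡⟨ solve 2 (λ k r → con 0ℚ :+ (con (↑ 2) :* con 0ℚ :+ con 1ℚ :- k) :* (con (+ 3 ℚ./ 4) :* r)
          :+ (con (↑ 2) :* con 0ℚ :+ con 1ℚ :- k) :* (con (+ 3 ℚ./ 4) :* r)
           := con ½ :* (con (↑ 3) :* r :* con 1ℚ :- con (↑ 3) :* k :* r)) refl κ ρ ⟩
    ½ * (↑ 3 * ρ * 1ℚ - ↑ 3 * κ * ρ)
      ≡⟨ cong (λ x → ½ * (↑ 3 * ρ * 1ℚ - x)) 3κρ≡1 ⟩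
    ½ * (↑ 3 * ρ * 1ℚ - 1ℚ) ∎
    where open ≡-Reasoning
  N-y (suc j) = trans (N-suc y y-periodic j) (classes (toℕ j) (mod3 (toℕ j)))
    where
    0≡ : 0ℚ ≡ ½ * (↑ 3 * ρ * 0ℚ - 0ℚ)
    0≡ = solve 1 (λ r → con 0ℚ := con ½ :* (con (↑ 3) :* r :* con 0ℚ :- con 0ℚ)) refl ρ

    classes : ∀ k → Mod3 k → y k + y (1 ℕ.+ k) + y (2 ℕ.+ k) ≡ ½ * (↑ 3 * ρ * identity 0F (res (suc k)) - 0ℚ)
    classes _ (0+ q) = trans (+₃-cong (y-0 q) (y-1 q) (y-2 q)) (trans
      (solve 1 (λ h → con 0ℚ :+ h :+ :- h := con 0ℚ) refl (h q))
      (trans 0≡ (cong (λ r → ½ * (↑ 3 * ρ * identity 0F r - 0ℚ)) (sym (res-class 1F q)))))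
    classes _ (1+ q) = trans (+₃-cong (y-1 q) (y-2 q) (y-0 (suc q))) (trans
      (solve 1 (λ h → h :+ :- h :+ con 0ℚ := con 0ℚ) refl (h q))
      (trans 0≡ (cong (λ r → ½ * (↑ 3 * ρ * identity 0F r - 0ℚ)) (sym (res-class 2F q)))))
    classes _ (2+ q) = trans (+₃-cong (y-2 q) (y-0 (suc q)) (trans (y-1 (suc q)) (h-suc q))) (trans
      (solve 2 (λ h r → :- h :+ con 0ℚ :+ (h :+ con (+ 3 ℚ./ 2) :* r) :=
          con ½ :* (con (↑ 3) :* r :* con 1ℚ :- con 0ℚ)) refl (h q) ρ)
      (cong (λ r → ½ * (↑ 3 * ρ * identity 0F r - 0ℚ)) (sym (res-class 0F (suc q)))))

  -- The weight `- 2` on class 0 cancels the two equal partial sums beside it; windows centred in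
  -- classes 1 and 2 are left with one increment of `H`, with opposite signs.
  N-z : ∀ (j : Fin m) → N (z ∘ toℕ) j ≡ y (toℕ j)
  N-z zero = trans (N-zero {2 ℕ.+ K′ ℕ.* 3} z z-periodic)
    (+₃-cong (cong (- ↑ 2 ℚ.*_) H-0) H-0 (trans (z-2 K′) H-K))
  N-z (suc j) = trans (N-suc z z-periodic j) (classes (toℕ j) (mod3 (toℕ j)))
    where
    classes : ∀ k → Mod3 k → z k + z (1 ℕ.+ k) + z (2 ℕ.+ k) ≡ y (suc k)
    classes _ (0+ q) = trans (+₃-cong (z-0 q) (z-1 q) (trans (z-2 q) (H-suc q))) (trans
      (solve 2 (λ H h → con (- ↑ 2) :* H :+ H :+ (H :+ h) := h) refl (H q) (h q)) (sym (y-1 q)))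
    classes _ (1+ q) = trans (+₃-cong (z-1 q) (trans (z-2 q) (H-suc q))
        (trans (z-0 (suc q)) (cong (- ↑ 2 ℚ.*_) (H-suc q)))) (trans
      (solve 2 (λ H h → H :+ (H :+ h) :+ con (- ↑ 2) :* (H :+ h) := :- h) refl (H q) (h q)) (sym (y-2 q)))
    classes _ (2+ q) = trans (+₃-cong (z-2 q) (z-0 (suc q)) (z-1 (suc q))) (trans
      (solve 1 (λ H → H :+ con (- ↑ 2) :* H :+ H := con 0ℚ) refl (H (suc q))) (sym (y-0 (suc q))))

  N-Y : ∀ i j → N (λ k → Y k j) i ≡ ½ * (T i j - identity i j)
  N-Y i j = trans (N-circulant Y-circulant i j)
    (circulant-ext (N-row-circulant Y-circulant)
      (λ i j → cong₂ (λ x y → ½ * (x - y)) (T-circulant i j) (identity-circulant i j)) N-y i j)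

  N-Z : ∀ i j → N (λ k → Z k j) i ≡ Y i j
  N-Z i j = trans (N-circulant Z-circulant i j)
    (circulant-ext (N-row-circulant Z-circulant) Y-circulant N-z i j)

  penrose : PenroseEquations
    (block 0ℚ (replicate m 1ℚ) (replicate m 1ℚ) rimBlock)
    (block (ρ * (↑ 6 - ↑ 2 * ↑ m)) (replicate m ρ) (replicate m ρ) Y)
  penrose = penrose-block ρ m*ρ≡1 T Y Z T-sym T-circulant Y-circulant N-T N-Y N-Z

-- Parity of `n` and the first row of `P`

data Parity : ℕ → Set where
  even : ∀ t → Parity (t ℕ.* 2)
  odd  : ∀ t → Parity (suc (t ℕ.* 2))

parity : ∀ k → Parity k
parity zero = even 0
parity (suc k) with parity k
... | even t = odd t
... | odd  t = even (suc t)

2∣n : ∀ t → 2 ∣ 4 ℕ.+ t ℕ.* 2 ℕ.* 3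
2∣n t = divides (2 ℕ.+ t ℕ.* 3) (cong (4 ℕ.+_) (t*6-half t))

2∤n : ∀ t → ¬ 2 ∣ suc (t ℕ.* 2 ℕ.* 3)
2∤n t 2∣n = contradiction (∣m+n∣m⇒∣n (subst (2 ∣_) (ℕ.+-comm 1 (t ℕ.* 2 ℕ.* 3)) 2∣n)
    (divides (t ℕ.* 3) (t*6-half t)))
                          (>⇒∤ (s≤s (s≤s z≤n)))

module _ (K′ : ℕ) where
  open Inverse K′

  FoldedRow : Vector ℚ m → Set
  FoldedRow v = ∀ {ℓ} (j : Fin m) → Folded j ℓ →
    v j ≡ (↑ 2 * ↑ suc m - ↑ suc m * ↑ suc m) * δ (toℕ j) 0 + foldedRow m ℓ

-- Records whichever of `z₁` and `z₂` the divisibility test selects, so that the later comparison is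
-- free of parity.
record RowOfP (K′ : ℕ) : Set where
  open Inverse K′
  field
    v   : Vector ℚ m
    row : FoldedRow K′ v
    P≡  : ∀ i j → P m i j ≡ (+ 1 ℚ./ (3 ℕ.* m)) * Circ v i j

rowOfP : ∀ {K′} → Parity K′ → RowOfP K′
-- `K′ = 2t` gives `m = 6t + 3`, so even `K′` corresponds to even `n`.
rowOfP (even t) = record
  { v   = z₁ m
  ; row = Even.z₁≡ t
  ; P≡  = λ i j → cong (λ b → (+ 1 ℚ./ (3 ℕ.* m)) * (if b then Circ (z₁ m) else Circ (z₂ m)) i j)
                       (dec-true (2 ∣? suc m) (2∣n t))
  }
  where m = suc (t ℕ.* 2) ℕ.* 3
rowOfP (odd s) = record
  { v   = z₂ m
  ; row = Odd.z₂≡ s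
  ; P≡  = λ i j → cong (λ b → (+ 1 ℚ./ (3 ℕ.* m)) * (if b then Circ (z₁ m) else Circ (z₂ m)) i j)
                       (dec-false (2 ∣? suc m) (2∤n (suc s)))
  }
  where m = suc s ℕ.* 2 ℕ.* 3

-- The claimed inverse in block form

module _ (K′ : ℕ) where
  open Inverse K′

  candidate : Matrix ℚ (suc m) (suc m)
  candidate = (ℚ.- ½) ·ᴹ L̂ m +ᴹ (+ 6 ℚ./ m) ·ᴹ outer (w m) (w m)

  private
    μ : ℚ
    μ = ↑ m

    ⅓ ⅙ : ℚ
    ⅓ = + 1 ℚ./ 3
    ⅙ = + 1 ℚ./ 6

    μ≡ : μ ≡ κ * ↑ 3
    μ≡ = ↑-* K 3

    n≡ : ↑ suc m ≡ 1ℚ + μ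
    n≡ = ↑-+ 1 m

    m/3≡ : + m ℚ./ 3 ≡ μ * ⅓
    m/3≡ = /-as-* m 3

    6/m≡ : + 6 ℚ./ m ≡ ↑ 6 * ρ
    6/m≡ = /-as-* 6 m

    1/3m≡ : + 1 ℚ./ (3 ℕ.* m) ≡ ⅓ * ρ
    1/3m≡ = /-* (+ 1) (+ 1) 3 m

    -- The ring solver does not know `mρ = 1`. An identity that relies on it is stated modulo
    -- `mρ - 1`, with the explicit cofactor `q`.
    reduce : ∀ {x y} q → x ≡ y + q * (μ * ρ - 1ℚ) → x ≡ y
    reduce {x} {y} q eq = trans eq (trans (cong (λ u → y + q * (u - 1ℚ)) m*ρ≡1)
      (solve 2 (λ y q → y :+ q :* (con 1ℚ :- con 1ℚ) := y) refl y q))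

    -- What an entry of `candidate` unfolds to: `i`, `b` and `d` are the entries of the identity, of
    -- the border block and of the block holding `P`; `u` and `v` are entries of `w`.
    formula : ℚ → ℚ → ℚ → ℚ → ℚ → ℚ
    formula i b d u v = - ½ * (+ m ℚ./ 3 * i + - (⅓ * b) + d) + + 6 ℚ./ m * (u * v)

    formula′ : ℚ → ℚ → ℚ → ℚ → ℚ → ℚ
    formula′ i b d u v = - ½ * (μ * ⅓ * i + - (⅓ * b) + d) + ↑ 6 * ρ * (u * v)

    formula≡ : ∀ i b d u v → formula i b d u v ≡ formula′ i b d u v
    formula≡ i b d u v = cong₂ (λ x y → - ½ * (x * i + - (⅓ * b) + d) + y * (u * v)) m/3≡ 6/m≡

    w₀ : ⅙ * (↑ 7 - ↑ suc m) ≡ ⅙ * (↑ 6 - μ)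
    w₀ = trans (cong (λ n → ⅙ * (↑ 7 - n)) n≡)
      (solve 1 (λ m → con ⅙ :* (con (↑ 7) :- (con 1ℚ :+ m)) := con ⅙ :* (con (↑ 6) :- m)) refl μ)

    hub-hub : formula 1ℚ 0ℚ 0ℚ (⅙ * (↑ 7 - ↑ suc m)) (⅙ * (↑ 7 - ↑ suc m)) ≡ ρ * (↑ 6 - ↑ 2 * μ)
    hub-hub = trans (formula≡ 1ℚ 0ℚ 0ℚ (⅙ * (↑ 7 - ↑ suc m)) (⅙ * (↑ 7 - ↑ suc m)))
      (trans (cong₂ (formula′ 1ℚ 0ℚ 0ℚ) w₀ w₀)
      (reduce (⅙ * μ)
        (solve 2 (λ m r → con (- ½) :* (m :* con ⅓ :* con 1ℚ :+ :- (con ⅓ :* con 0ℚ) :+ con 0ℚ)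
             :+ con (↑ 6) :* r :* (con ⅙ :* (con (↑ 6) :- m) :* (con ⅙ :* (con (↑ 6) :- m)))
           := r :* (con (↑ 6) :- con (↑ 2) :* m) :+ con ⅙ :* m :* (m :* r :- con 1ℚ)) refl μ ρ)))

    hub-rim : formula 0ℚ 1ℚ 0ℚ (⅙ * (↑ 7 - ↑ suc m)) (⅙ * 1ℚ) ≡ ρ
    hub-rim = trans (formula≡ 0ℚ 1ℚ 0ℚ (⅙ * (↑ 7 - ↑ suc m)) (⅙ * 1ℚ))
      (trans (cong (λ u → formula′ 0ℚ 1ℚ 0ℚ u (⅙ * 1ℚ)) w₀)
      (reduce (- ⅙)
        (solve 2 (λ m r → con (- ½) :* (m :* con ⅓ :* con 0ℚ :+ :- (con ⅓ :* con 1ℚ) :+ con 0ℚ)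
             :+ con (↑ 6) :* r :* (con ⅙ :* (con (↑ 6) :- m) :* (con ⅙ :* con 1ℚ))
           := r :+ con (- ⅙) :* (m :* r :- con 1ℚ)) refl μ ρ)))

    rim-hub : formula 0ℚ 1ℚ 0ℚ (⅙ * 1ℚ) (⅙ * (↑ 7 - ↑ suc m)) ≡ ρ
    rim-hub = trans (cong (λ x → - ½ * (+ m ℚ./ 3 * 0ℚ + - (⅓ * 1ℚ) + 0ℚ) + + 6 ℚ./ m * x)
        (ℚ.*-comm (⅙ * 1ℚ) (⅙ * (↑ 7 - ↑ suc m)))) hub-rim

    rim : ℚ → ℚ → ℚ
    rim i x = formula i 0ℚ (⅓ * ρ * x) (⅙ * 1ℚ) (⅙ * 1ℚ)

    rim≡ : ∀ i x → rim i x ≡ ⅙ * ρ * (1ℚ - x) - ⅙ * μ * i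
    rim≡ i x = trans (formula≡ i 0ℚ (⅓ * ρ * x) (⅙ * 1ℚ) (⅙ * 1ℚ))
      (solve 4 (λ m r i x → con (- ½) :* (m :* con ⅓ :* i :+ :- (con ⅓ :* con 0ℚ) :+ con ⅓ :* r :* x)
             :+ con (↑ 6) :* r :* (con ⅙ :* con 1ℚ :* (con ⅙ :* con 1ℚ))
           := con ⅙ :* r :* (con 1ℚ :- x) :- con ⅙ :* m :* i) refl μ ρ i x)

    α≡ : ∀ q → α m (suc q) ≡ (↑ 3 * (1ℚ + κ * ↑ 3) - ↑ 18 * (1ℚ + ↑ q) + ↑ 8) * ½
    α≡ q = cong₂ (λ x y → (↑ 3 * x - ↑ 18 * y + ↑ 8) * ½) (trans n≡ (cong (1ℚ ℚ.+_) μ≡)) (↑-+ 1 q)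

    β≡ : ∀ q → β m (suc q) ≡ (↑ 3 * (1ℚ + κ * ↑ 3) - ↑ 18 * (1ℚ + ↑ q) + ↑ 4) * ½
    β≡ q = cong₂ (λ x y → (↑ 3 * x - ↑ 18 * y + ↑ 4) * ½) (trans n≡ (cong (1ℚ ℚ.+_) μ≡)) (↑-+ 1 q)

    -- The summand 1 is the contribution of `ww′`. At index `q + 1` both `1 - α` and `- (1 + β)`
    -- equal `9(2q + 1 - κ)/2`, which the factor `ρ/6` turns into `h q`; on multiples of 3 the entry
    -- 1 is cancelled.
    foldedRow-y : ∀ ℓ → Mod3 ℓ → ℓ ≢ 0 → ⅙ * ρ * (1ℚ - foldedRow m ℓ) ≡ y ℓ
    foldedRow-y _ (0+ zero)    ℓ≢0 = contradiction refl ℓ≢0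
    foldedRow-y _ (0+ (suc q)) _   = trans (cong (λ v → ⅙ * ρ * (1ℚ - v)) (foldedRow-0 m q))
      (trans (solve 1 (λ r → con ⅙ :* r :* (con 1ℚ :- con 1ℚ) := con 0ℚ) refl ρ) (sym (y-0 (suc q))))
    foldedRow-y _ (1+ q) _ = trans (cong (λ v → ⅙ * ρ * (1ℚ - v)) (trans (foldedRow-1 m q) (α≡ q)))
      (trans (solve 3 (λ r k q → con ⅙ :* r :* (con 1ℚ
          :- (con (↑ 3) :* (con 1ℚ :+ k :* con (↑ 3)) :- con (↑ 18) :* (con 1ℚ :+ q) :+ con (↑ 8)) :* con ½)
          := (con (↑ 2) :* q :+ con 1ℚ :- k) :* (con (+ 3 ℚ./ 4) :* r)) refl ρ κ (↑ q))
        (sym (y-1 q)))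
    foldedRow-y _ (2+ q) _ = trans (cong (λ v → ⅙ * ρ * (1ℚ - v)) (trans (foldedRow-2 m q) (cong -_ (β≡ q))))
      (trans (solve 3 (λ r k q → con ⅙ :* r :* (con 1ℚ
          :- :- ((con (↑ 3) :* (con 1ℚ :+ k :* con (↑ 3)) :- con (↑ 18) :* (con 1ℚ :+ q)
          :+ con (↑ 4)) :* con ½))
          := :- ((con (↑ 2) :* q :+ con 1ℚ :- k) :* (con (+ 3 ℚ./ 4) :* r))) refl ρ κ (↑ q))
        (sym (y-2 q)))

    complement : ∀ {d ℓ d′} → d ℕ.+ ℓ ≡ m → d′ ℕ.+ ℓ ≡ m → d ≡ d′
    complement {d} {ℓ} {d′} e e′ = ℕ.+-cancelʳ-≡ ℓ d d′ (trans e (sym e′))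

    q≤K′ : ∀ {d r} q → d ℕ.+ (suc r ℕ.+ q ℕ.* 3) ≡ m → q ≤ K′
    q≤K′ {d} {r} q e = ℕ.s≤s⁻¹ (*3-cancel-< q K (ℕ.≤-trans (s≤s (ℕ.m≤n+m (q ℕ.* 3) r))
      (ℕ.≤-trans (ℕ.m≤n+m (suc r ℕ.+ q ℕ.* 3) d) (ℕ.≤-reflexive e))))

    -- Reflecting the cycle exchanges the classes 1 and 2, where `y` has opposite signs; the
    -- antisymmetry of `h` compensates.
    y-reflect : ∀ {d} ℓ → Mod3 ℓ → d ℕ.+ ℓ ≡ m → y ℓ ≡ y d
    y-reflect {d} _ (0+ q) e = trans (y-0 q) (sym (trans (cong y (complement {d} e e′)) (y-0 (K ∸ q))))
      where
      q≤K : q ≤ K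
      q≤K = ℕ.*-cancelʳ-≤ q K 3 (ℕ.≤-trans (ℕ.m≤n+m (q ℕ.* 3) d) (ℕ.≤-reflexive e))

      e′ : (K ∸ q) ℕ.* 3 ℕ.+ q ℕ.* 3 ≡ m
      e′ = trans (sym (ℕ.*-distribʳ-+ 3 (K ∸ q) q)) (cong (ℕ._* 3) (ℕ.m∸n+n≡m q≤K))
    y-reflect {d} _ (1+ q) e = trans (y-1 q) (trans (sym (h-reflect q s (ℕ.m+[n∸m]≡n q≤)))
        (sym (trans (cong y (complement {d} {_} {2 ℕ.+ s ℕ.* 3} e e′)) (y-2 s))))
      where
      q≤ = q≤K′ {d} q e
      s = K′ ∸ q

      e′ : 2 ℕ.+ s ℕ.* 3 ℕ.+ (1 ℕ.+ q ℕ.* 3) ≡ m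
      e′ = cong (2 ℕ.+_) (trans (ℕ.+-suc (s ℕ.* 3) (q ℕ.* 3))
        (cong suc (trans (sym (ℕ.*-distribʳ-+ 3 s q)) (cong (ℕ._* 3) (ℕ.m∸n+n≡m q≤)))))
    y-reflect {d} _ (2+ q) e = trans (y-2 q) (trans (h-reflect s q (ℕ.m∸n+n≡m q≤))
        (sym (trans (cong y (complement {d} {_} {1 ℕ.+ s ℕ.* 3} e e′)) (y-1 s))))
      where
      q≤ = q≤K′ {d} q e
      s = K′ ∸ q

      e′ : 1 ℕ.+ s ℕ.* 3 ℕ.+ (2 ℕ.+ q ℕ.* 3) ≡ m
      e′ = cong suc (trans (ℕ.+-suc (s ℕ.* 3) (suc (q ℕ.* 3))) (cong suc (trans (ℕ.+-suc (s ℕ.* 3) (q ℕ.* 3))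
        (cong suc (trans (sym (ℕ.*-distribʳ-+ 3 s q)) (cong (ℕ._* 3) (ℕ.m∸n+n≡m q≤)))))))

    y-folded : ∀ {j : Fin m} {ℓ} → Folded j ℓ → y ℓ ≡ y (toℕ j)
    y-folded (inj₁ refl , _)           = refl
    y-folded {j} {ℓ} (inj₂ d+ℓ≡m , _) = y-reflect {toℕ j} ℓ (mod3 ℓ) d+ℓ≡m

  row-zero : ∀ v → FoldedRow K′ v → ∀ j → rim (identity zero j) (v j) ≡ y (toℕ j)
  -- Since `2n - n² = 1 - m²`, the diagonal entry is `⅙ρm² - ⅙m`, which is `⅙m` times `mρ - 1`.
  row-zero v row zero = trans (rim≡ 1ℚ (v zero)) (trans
    (cong (λ x → ⅙ * ρ * (1ℚ - x) - ⅙ * μ * 1ℚ)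
        (trans (row zero (inj₁ refl , z≤n)) (cong (λ n → (↑ 2 * n - n * n) * 1ℚ + 0ℚ) n≡)))
    (reduce (⅙ * μ) (solve 2 (λ m r → con ⅙ :* r :* (con 1ℚ
        :- ((con (↑ 2) :* (con 1ℚ :+ m) :- (con 1ℚ :+ m) :* (con 1ℚ :+ m)) :* con 1ℚ :+ con 0ℚ))
        :- con ⅙ :* m :* con 1ℚ
      := con 0ℚ :+ con ⅙ :* m :* (m :* r :- con 1ℚ)) refl μ ρ)))
  row-zero v row (suc j) = begin
    rim 0ℚ (v (suc j))
      ≡⟨ rim≡ 0ℚ (v (suc j)) ⟩
    ⅙ * ρ * (1ℚ - v (suc j)) - ⅙ * μ * 0ℚ
      ≡⟨ cong (λ x → ⅙ * ρ * (1ℚ - x) - ⅙ * μ * 0ℚ) (row (suc j) ℓ-folded) ⟩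
    ⅙ * ρ * (1ℚ - (x * 0ℚ + foldedRow m ℓ)) - ⅙ * μ * 0ℚ
      ≡⟨ solve 4 (λ r x v m → con ⅙ :* r :* (con 1ℚ :- (x :* con 0ℚ :+ v)) :- con ⅙ :* m :* con 0ℚ :=
          con ⅙ :* r :* (con 1ℚ :- v)) refl ρ x (foldedRow m ℓ) μ ⟩
    ⅙ * ρ * (1ℚ - foldedRow m ℓ)
      ≡⟨ foldedRow-y ℓ (mod3 ℓ) (not-0 ℓ-folded) ⟩
    y ℓ
      ≡⟨ y-folded ℓ-folded ⟩
    y (toℕ (suc j)) ∎
    where
    open ≡-Reasoning
    x = ↑ 2 * ↑ suc m - ↑ suc m * ↑ suc m

    ℓ : ℕ
    ℓ = proj₁ (folded (suc j))

    ℓ-folded : Folded (suc j) ℓ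
    ℓ-folded = proj₂ (folded (suc j))

    not-0 : ∀ {ℓ} → Folded (suc j) ℓ → ℓ ≢ 0
    not-0 (inj₁ () , _)   refl
    not-0 (inj₂ d≡m , _)  refl = ℕ.<⇒≢ (toℕ<n (suc j)) (trans (sym (ℕ.+-identityʳ _)) d≡m)

  rim-rim : ∀ i j → formula (identity i j) 0ℚ (P m i j) (⅙ * 1ℚ) (⅙ * 1ℚ) ≡ Y i j
  rim-rim i j = trans
    (cong (λ x → formula (identity i j) 0ℚ x (⅙ * 1ℚ) (⅙ * 1ℚ)) (trans (P≡ i j) (cong (_* Circ v i j) 1/3m≡)))
    (circulant-ext {M = λ i j → rim (identity i j) (Circ v i j)} {Y}
      (λ i j → cong₂ rim (identity-circulant i j) (Circ-circulant v i j)) Y-circulant (row-zero v row) i j)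
    where open RowOfP (rowOfP (parity K′))

  candidate≗block : ∀ a b → candidate a b ≡ block (ρ * (↑ 6 - ↑ 2 * μ)) (replicate m ρ) (replicate m ρ) Y a b
  candidate≗block zero    zero    = hub-hub
  candidate≗block zero    (suc j) = hub-rim
  candidate≗block (suc i) zero    = rim-hub
  candidate≗block (suc i) (suc j) = rim-rim i j

cycle-length : ∀ m → 10 ≤ suc m → suc m % 3 ≡ 1 → ∃[ K′ ] m ≡ suc K′ ℕ.* 3
cycle-length m n≥10 n%3≡1 with suc m ℕ./ 3 | trans (m≡m%n+[m/n]*n (suc m) 3)
    (cong (ℕ._+ (suc m ℕ./ 3) ℕ.* 3) n%3≡1)
... | suc K′ | eq   = K′ , ℕ.suc-injective eq
... | zero   | refl with s≤s () ← n≥10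

module _ {c ℓ} (R : CommutativeRing c ℓ) (ι : ℚ → CommutativeRing.Carrier R)
         (ι-homo : RingMorphisms.IsRingHomomorphism ℚ.+-*-rawRing (CommutativeRing.rawRing R) ι) where
  open MatrixOps (CommutativeRing.rawRing R) using (IsMoorePenroseInverse) renaming
      (PenroseEquations to Penroseᴿ)

  wheel-penrose : ∀ {m} .{{_ : NonZero m}} (n≥10 : 10 ≤ suc m) → ∃[ K′ ] m ≡ suc K′ ℕ.* 3 →
    Penroseᴿ (mapᴹ ι (E m n≥10)) (mapᴹ ι ((ℚ.- ½) ·ᴹ L̂ m +ᴹ (+ 6 ℚ./ m) ·ᴹ outer (w m) (w m)))
  wheel-penrose n≥10 (K′ , refl) = penrose-homo R ℚ.+-*-rawRing ι ι-homo
    (penrose-cong +-*-commutativeRing (E≗block (2 ℕ.+ K′ ℕ.* 3) n≥10) (candidate≗block K′) (Inverse.penrose K′))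

-- The real numbers enter only as a commutative ring receiving ℚ. The Penrose equations are
-- transported along `ι`; uniqueness is proved in `R` itself, as a competing inverse need not have
-- entries in the image of ℚ.
theorem6p10 : ∀ {c ℓ} (R : CommutativeRing c ℓ)
    (ι : ℚ → CommutativeRing.Carrier R) →
    RingMorphisms.IsRingHomomorphism ℚ.+-*-rawRing (CommutativeRing.rawRing R) ι →
    ∀ (m : ℕ) .{{_ : NonZero m}} (n≥10 : 10 ≤ suc m) → suc m % 3 ≡ 1 →
    MatrixOps.IsMoorePenroseInverse (CommutativeRing.rawRing R)
    (mapᴹ ι (E m n≥10))
    (mapᴹ ι ((ℚ.- ½) ·ᴹ L̂ m +ᴹ (+ 6 ℚ./ m) ·ᴹ outer (w m) (w m)))
theorem6p10 R ι ι-homo m n≥10 n%3≡1 = record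
  { penrose = pen
  ; unique  = λ Y → penrose-unique R _ _ Y pen
  }
  where pen = wheel-penrose R ι ι-homo n≥10 (cycle-length m n≥10 n%3≡1)
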